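{- For $|q|<1$, $$\mathrm{C}\Phi_{11}(q)=\frac{1}{(q^{11};q^{11})_\infty}+11\sum_{j=1}^\infty p(11j-5)q^j.$$
   Context: A $k$-colored generalized Frobenius symbol is a two-row array with $d\ge 0$ columns whose entries are colored nonnegative integers $\ell_c$ ($\ell\ge 0$, color $c\in\{1,\dots,k\}$), each row strictly decreasing with respect to the total order $0_1\prec 0_2\prec\cdots\prec 0_k\prec 1_1\prec\cdots\prec 1_k\prec 2_1\prec\cdots$. It is a $k$-colored generalized Frobenius partition of $n=d+\sum(\text{integer values of all entries})$. $c\phi_k(n)$ is the number of such partitions of $n$ (with $c\phi_k(0)=1$), and $\mathrm{C}\Phi_k(q)=\sum_{n\ge0}c\phi_k(n)q^n$. $(a;q)_\infty=\prod_{j\ge1}(1-aq^{j-1})$ and $p(n)$ is the number of ordinary partitions of $n$. -}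

module Defs where

open import Data.Nat using (ℕ; zero; suc; _+_; _*_; _∸_; _<_; _≤_; _≥_; _%_; _/_)
open import Data.Nat.Properties using (_≟_)
open import Data.Fin using (Fin; toℕ)
open import Data.List using (List; length; map; _++_)
open import Data.Nat.ListAction using (sum)
open import Data.List.Relation.Unary.Linked using (Linked)
open import Data.List.Relation.Unary.All using (All)
open import Data.Product using (Σ; _×_; proj₁; _,_)
open import Data.Sum using (_⊎_)
open import Relation.Binary.PropositionalEquality using (_≡_)
open import Relation.Nullary using (yes; no)
open import Function.Bundles using (_↔_)

-- A k-colored nonnegative integer ℓ_c : value ℓ, color c ∈ Fin k (color c+1 in the paper).
Colored : ℕ → Set
Colored k = ℕ × Fin k

value : ∀ {k} → Colored k → ℕ
value = proj₁

_≺_ : ∀ {k} → Colored k → Colored k → Set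
(l , c) ≺ (l' , c') = (l < l') ⊎ ((l ≡ l') × (toℕ c < toℕ c'))

_≻_ : ∀ {k} → Colored k → Colored k → Set
x ≻ y = y ≺ x

StrictlyDecreasing : ∀ {k} → List (Colored k) → Set
StrictlyDecreasing = Linked _≻_

record FrobSymbol (k : ℕ) : Set where
  field
    top    : List (Colored k)
    bottom : List (Colored k)
    top-dec    : StrictlyDecreasing top
    bottom-dec : StrictlyDecreasing bottom
    same-len   : length top ≡ length bottom

weight : ∀ {k} → FrobSymbol k → ℕ
weight s = length top + (sum (map value top) + sum (map value bottom))
  where open FrobSymbol s

CFrob : ℕ → ℕ → Set
CFrob k n = Σ (FrobSymbol k) (λ s → weight s ≡ n)

record Partition (n : ℕ) : Set where
  field
    parts   : List ℕ
    nonincr : Linked (λ a b → b ≤ a) parts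
    pos     : All (λ a → 1 ≤ a) parts
    total   : sum parts ≡ n

HasSize : Set → ℕ → Set
HasSize A m = A ↔ Fin m

-- Coefficient of q^n in 1/(q^11;q^11)_∞ + 11 Σ_{j≥1} p(11j-5) q^j, given p.
rhsCoeff : (ℕ → ℕ) → ℕ → ℕ
rhsCoeff p zero = p 0
rhsCoeff p (suc m) = first + 11 * p (11 * suc m ∸ 5)
  where
    first : ℕ
    first with suc m % 11 ≟ 0
    ... | yes _ = p (suc m / 11)
    ... | no _  = 0

{-# OPTIONS --safe #-}

-- A symbol is a pair of finite sets of positions 11 l + c. Let its residue be the sum of the colours
-- in the top row minus that in the bottom row, modulo 11. Rotating the colours inside the first
-- level l that is neither empty nor full changes the residue by any prescribed amount, so the
-- symbols with such a level are equidistributed over the residues. The others have residue 0 and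
-- are 11-fold copies of ordinary Frobenius symbols, that is, of partitions of n / 11. It remains to
-- see that the symbols of residue 1 are equinumerous with the partitions of 11 n - 5.
--
-- Colour by colour, a symbol is an 11-tuple of Maya diagrams with charges c in the lattice A₁₀, and
-- its weight is |c|² / 2 plus a part that survives shifting the diagrams; residue 1 means
-- ρ · c ≡ 1 (mod 11) for ρ = (-5 , … , 5). Splitting the Maya diagram of a partition of 11 n - 5 by
-- residue classes (its 11-core and 11-quotient) gives such tuples with |c|² replaced by
-- |c′ + ρ / 11|². The two sets of vectors c and c′ + ρ / 11 correspond under an explicit rational
-- orthogonal matrix V / 11, which exists because the 11-neighbour of A₁₀ along ρ is again A₁₀.

module Submission where

open import Defs
open import Data.Nat using (ℕ)

import Algebra.Properties.AbelianGroup
import Algebra.Properties.CommutativeMonoid.Sum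
import Algebra.Properties.Semiring.Sum
open import Axiom.UniquenessOfIdentityProofs using (module Decidable⇒UIP)
open import Data.Bool.Base using (Bool; true; false; not; if_then_else_; _∧_) renaming (T to IsTrue)
open import Data.Bool.Properties using (not-involutive) renaming (_≟_ to _≟ᵇ_)
open import Data.Empty using (⊥-elim)
open import Data.Fin.Base as Fin using (Fin; toℕ; fromℕ<; opposite)
open import Data.Fin.Permutation using (permutation)
open import Data.Fin.Properties
  using (all?; toℕ<n; toℕ-injective; toℕ-fromℕ<; opposite-involutive; opposite-prop; +↔⊎; *↔×)
open import Data.Integer.Base as ℤ using (ℤ; -[1+_]) renaming (+_ to pos)
import Data.Integer.Properties as ℤ
import Data.Integer.Tactic.RingSolver as ℤ-Solver
open import Data.List.Base as List using (List; []; _∷_; length; reverse; reverseAcc)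
open import Data.List.Properties using (reverse-involutive; map-∘; map-id; map-cong; length-map; length-reverse)
open import Data.List.Relation.Binary.Permutation.Propositional.Properties using (↭-reverse; map⁺)
open import Data.List.Relation.Unary.All as All using (All; []; _∷_)
open import Data.List.Relation.Unary.Linked as Linked using (Linked; []; [-]; _∷_)
import Data.List.Relation.Unary.Linked.Properties as Linked
open import Data.Nat.ListAction using () renaming (sum to listSum)
open import Data.Nat.ListAction.Properties using (sum-↭)
import Data.Nat.Tactic.RingSolver as ℕ-Solver
open import Data.Product.Base using (Σ; _×_; _,_; proj₁; proj₂; ∃)
open import Data.Product.Function.NonDependent.Propositional using (_×-↔_)
open import Data.Sum.Base using (_⊎_; inj₁; inj₂)
open import Data.Sum.Function.Propositional using (_⊎-↔_)
open import Data.Unit.Base using (⊤; tt)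
open import Data.Vec.Base as Vec using (Vec; []; _∷_; _∷ʳ_; lookup; tabulate; zipWith; replicate; initLast; init; last)
open import Data.Vec.Properties
  using (lookup-zipWith; lookup-replicate; lookup-map; map-replicate; tabulate∘lookup; lookup∘tabulate; tabulate-cong)
open import Function.Base using (_∘_; const; id)
open import Function.Bundles using (_↔_; mk↔ₛ′)
open import Function.Construct.Composition using (_↔-∘_)
open import Function.Construct.Identity using (↔-id)
open import Function.Construct.Symmetry using (↔-sym)
open import Relation.Binary.Definitions using (tri<; tri≈; tri>) renaming (Irrelevant to Irrelevant₂)
open import Relation.Binary.PropositionalEquality
open import Relation.Nullary using (¬_; Irrelevant; yes; no)
open import Relation.Nullary.Decidable using (from-yes)

-- The number 5 comes from `ρ · ρ = 110`. Let I be the sum of the shift-invariant parts of the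
-- eleven doubled energies. A coloured symbol of weight n has 2 n = I + |c|², whereas a partition of
-- N has 2 N = 11 (I + |c′|²) + 2 ρ · c′. Completing the square turns the latter into 2 N + 10 = 11
-- (I + |c′ + ρ / 11|²), so the two lengths agree exactly when N + 5 = 11 n. Modulo 11 this equation
-- forces ρ · c′ ≡ -5, and that is precisely the condition under which V / 11 takes c′ + ρ / 11 back
-- to an integer vector. An equality of theta series would give only equal counts after summation.
-- Here a bijection is wanted in each weight, so the isometry has to be explicit and to respect both
-- cosets. Finite sets are coded by gaps: every list of naturals is a code, equality of sets is
-- equality of lists, and the same lists code partitions. Energies are doubled because particles sit
-- at half-integers, and additive forms of the identities replace subtraction in ℕ.

module ℤ-Group = Algebra.Properties.AbelianGroup ℤ.+-0-abelianGroup
module ℤΣ = Algebra.Properties.Semiring.Sum ℤ.+-*-semiring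

-- Integer vectors and an explicit isometry in dimension eleven

module Lattice where

  open import Data.Fin using (#_)
  open import Data.Integer.Base using (+_; _+_; _*_; _-_; -_)
  open import Data.Integer.DivMod using (_/ℕ_)
  open import Data.Nat.Base using (suc)

  Point : ℕ → Set
  Point n = Fin n → ℤ

  total : ∀ {n} → Point n → ℤ
  total = ℤΣ.sum

  dot : ∀ {n} → Point n → Point n → ℤ
  dot x y = total (λ i → x i * y i)

  Matrix : ℕ → Set
  Matrix n = Fin n → Fin n → ℤ

  mul : ∀ {n} → Matrix n → Point n → Point n
  mul A x i = dot (A i) x

  total-cong : ∀ {n} {x y : Point n} → (∀ i → x i ≡ y i) → total x ≡ total y
  total-cong {n} = ℤΣ.sum-cong-≗ {n}

  total-+ : ∀ {n} (x y : Point n) → total (λ i → x i + y i) ≡ total x + total y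
  total-+ {n} = ℤΣ.∑-distrib-+ {n}

  total-* : ∀ {n} k (x : Point n) → total (λ i → k * x i) ≡ k * total x
  total-* {n} k x = sym (ℤΣ.*-distribˡ-sum {n} k x)

  dot-cong : ∀ {n} {x x′ y y′ : Point n} → (∀ i → x i ≡ x′ i) → (∀ i → y i ≡ y′ i) → dot x y ≡ dot x′ y′
  dot-cong p q = total-cong (λ i → cong₂ _*_ (p i) (q i))

  dot-+ʳ : ∀ {n} (x y z : Point n) → dot x (λ i → y i + z i) ≡ dot x y + dot x z
  dot-+ʳ x y z = trans (total-cong (λ i → ℤ.*-distribˡ-+ (x i) (y i) (z i)))
    (total-+ (λ i → x i * y i) (λ i → x i * z i))

  dot-*ʳ : ∀ {n} k (x y : Point n) → dot x (λ i → k * y i) ≡ k * dot x y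
  dot-*ʳ k x y = trans (total-cong (λ i → alg k (x i) (y i))) (total-* k (λ i → x i * y i))
    where
    alg : ∀ k x y → x * (k * y) ≡ k * (x * y)
    alg = ℤ-Solver.solve-∀

  dot-comm : ∀ {n} (x y : Point n) → dot x y ≡ dot y x
  dot-comm x y = total-cong (λ i → ℤ.*-comm (x i) (y i))

  dot-mul : ∀ {n} (A : Matrix n) (x y : Point n) → dot (mul A x) y ≡ dot x (mul (λ i j → A j i) y)
  dot-mul {n} A x y = begin
    total (λ i → total (λ a → A i a * x a) * y i)
      ≡⟨ total-cong (λ i → ℤΣ.*-distribʳ-sum {n} (y i) (λ a → A i a * x a)) ⟩
    total (λ i → total (λ a → A i a * x a * y i))
      ≡⟨ ℤΣ.∑-comm {n} {n} (λ i a → A i a * x a * y i) ⟩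
    total (λ a → total (λ i → A i a * x a * y i))
      ≡⟨ total-cong (λ a → trans (total-cong (λ i → alg (A i a) (x a) (y i))) (total-* (x a) (λ i → A i a * y i))) ⟩
    total (λ a → x a * total (λ i → A i a * y i))  ∎
    where
    open ≡-Reasoning
    alg : ∀ a x y → a * x * y ≡ x * (a * y)
    alg = ℤ-Solver.solve-∀

  δ : ∀ {n} → Matrix n
  δ Fin.zero    Fin.zero    = + 1
  δ Fin.zero    (Fin.suc _) = + 0
  δ (Fin.suc _) Fin.zero    = + 0
  δ (Fin.suc i) (Fin.suc j) = δ i j

  mul-δ : ∀ {n} (x : Point n) i → mul δ x i ≡ x i
  mul-δ {suc n} x Fin.zero    = trans (cong₂ _+_ (ℤ.*-identityˡ (x Fin.zero)) (ℤΣ.sum-replicate-zero n)) (ℤ.+-identityʳ _)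
  mul-δ {suc n} x (Fin.suc i) = trans (ℤ.+-identityˡ _) (mul-δ (x ∘ Fin.suc) i)

  -- The Weyl vector of A₁₀ and its 11-neighbour

  ρ : Point 11
  ρ i = + toℕ i - + 5

  -- U is chosen so that V i a is the residue of 2 + ρᵢ ρₐ modulo 11 in [-4 , 6], except for the
  -- central entry -9.
  U : Matrix 11
  U i a = - ((ρ i * ρ a + + 6) /ℕ 11) - δ i (# 5) * δ a (# 5)

  V : Matrix 11
  V i a = + 2 + ρ i * ρ a + + 11 * U i a

  -- This is `(U ρ - 6 ρ) / 11`. Through `V-expand` it records that `V ρ = 55 ρ + 121 (ρ + μ)`, so
  -- `V ρ` is `55 ρ` modulo 121.
  μ : Point 11
  μ = lookup (+ 7 ∷ + 6 ∷ + 4 ∷ + 3 ∷ + 1 ∷ + 0 ∷ - + 1 ∷ - + 3 ∷ - + 4 ∷ - + 6 ∷ - + 7 ∷ [])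

  V-symmetric : ∀ i a → V i a ≡ V a i
  V-symmetric = from-yes (all? (λ i → all? (λ a → V i a ℤ.≟ V a i)))

  -- Together with `V-symmetric` this says that the square of `V` is 121. On the diagonal: if `ρ i`
  -- is not 0, then `ρ i * ρ a` runs through all residues, so the row permutes -4, ..., 6, with sum
  -- 11 and sum of squares 121. The central row has ten entries 2 and one entry -9, with the same
  -- two sums; this is why the central entry is exceptional.
  V²≡121 : ∀ a b → dot (V a) (V b) ≡ + 121 * δ a b
  V²≡121 = from-yes (all? (λ a → all? (λ b → dot (V a) (V b) ℤ.≟ + 121 * δ a b)))

  V-row : ∀ i → total (V i) ≡ + 11
  V-row = from-yes (all? (λ i → total (V i) ℤ.≟ + 11))

  Uρ : ∀ i → mul U ρ i ≡ + 6 * ρ i + + 11 * μ i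
  Uρ = from-yes (all? (λ i → mul U ρ i ℤ.≟ + 6 * ρ i + + 11 * μ i))

  -- Modulo 11 only a matrix of rank two survives, so `V x` modulo 11 depends on `total x` and
  -- `dot ρ x` alone.
  V-expand : ∀ x i → mul V x i ≡ + 2 * total x + ρ i * dot ρ x + + 11 * mul U x i
  V-expand x i = begin
    total (λ a → (+ 2 + ρ i * ρ a + + 11 * U i a) * x a)
      ≡⟨ total-cong (λ a → alg (ρ i) (ρ a) (U i a) (x a)) ⟩
    total (λ a → + 2 * x a + ρ i * (ρ a * x a) + + 11 * (U i a * x a))
      ≡⟨ trans (total-+ (λ a → + 2 * x a + ρ i * (ρ a * x a)) (λ a → + 11 * (U i a * x a)))
           (cong₂ _+_ (total-+ (λ a → + 2 * x a) (λ a → ρ i * (ρ a * x a))) (total-* (+ 11) (λ a → U i a * x a))) ⟩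
    total (λ a → + 2 * x a) + total (λ a → ρ i * (ρ a * x a)) + + 11 * mul U x i
      ≡⟨ cong (_+ + 11 * mul U x i) (cong₂ _+_ (total-* (+ 2) x) (total-* (ρ i) (λ a → ρ a * x a))) ⟩
    + 2 * total x + ρ i * dot ρ x + + 11 * mul U x i ∎
    where
    open ≡-Reasoning
    alg : ∀ r s u x → (+ 2 + r * s + + 11 * u) * x ≡ + 2 * x + r * (s * x) + + 11 * (u * x)
    alg = ℤ-Solver.solve-∀

  mul-cong : ∀ {x y : Point 11} → (∀ i → x i ≡ y i) → ∀ i → mul V x i ≡ mul V y i
  mul-cong eq i = dot-cong (λ a → refl {x = V i a}) eq

  dot-V : ∀ x y → dot (mul V x) y ≡ dot x (mul V y)
  dot-V x y = trans (dot-mul V x y)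
    (dot-cong (λ a → refl {x = x a}) (λ a → dot-cong (λ i → V-symmetric i a) (λ i → refl {x = y i})))

  V-involutive : ∀ x i → mul V (mul V x) i ≡ + 121 * x i
  V-involutive x i = begin
    dot (V i) (mul V x)              ≡⟨ dot-V (V i) x ⟨
    dot (mul V (V i)) x              ≡⟨ dot-cong (λ a → trans (dot-comm (V a) (V i)) (V²≡121 i a)) (λ a → refl {x = x a}) ⟩
    dot (λ a → + 121 * δ i a) x      ≡⟨ dot-comm (λ a → + 121 * δ i a) x ⟩
    dot x (λ a → + 121 * δ i a)      ≡⟨ dot-*ʳ (+ 121) x (δ i) ⟩
    + 121 * dot x (δ i)              ≡⟨ cong (+ 121 *_) (trans (dot-comm x (δ i)) (mul-δ x i)) ⟩
    + 121 * x i                      ∎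
    where open ≡-Reasoning

  -- V / 11 is an isometry; it carries c to c′ + ρ / 11.
  record Neighbour (c c′ : Point 11) : Set where
    constructor neighbour
    field image : ∀ i → + 11 * c′ i + ρ i ≡ mul V c i

  open Neighbour

  -- The all-ones vector is an eigenvector of the self-adjoint `V` with eigenvalue 11, and `ρ` has
  -- total 0.
  Neighbour-total : ∀ {c c′} → Neighbour c c′ → total c′ ≡ total c
  Neighbour-total {c} {c′} nb = ℤ.*-cancelˡ-≡ (+ 11) (total c′) (total c) (begin
    + 11 * total c′                       ≡⟨ ℤ.+-identityʳ (+ 11 * total c′) ⟨
    + 11 * total c′ + total ρ             ≡⟨ cong (_+ total ρ) (total-* (+ 11) c′) ⟨
    total (λ i → + 11 * c′ i) + total ρ   ≡⟨ total-+ (λ i → + 11 * c′ i) ρ ⟨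
    total (λ i → + 11 * c′ i + ρ i)       ≡⟨ total-cong (image nb) ⟩
    total (mul V c)                       ≡⟨ total-cong (λ i → sym (ℤ.*-identityʳ (mul V c i))) ⟩
    dot (mul V c) (const (+ 1))           ≡⟨ dot-V c (const (+ 1)) ⟩
    dot c (mul V (const (+ 1)))           ≡⟨ dot-cong (λ a → refl {x = c a}) (λ a → trans (total-cong (λ i → ℤ.*-identityʳ (V a i))) (V-row a)) ⟩
    dot c (const (+ 11))                  ≡⟨ dot-comm c (const (+ 11)) ⟩
    dot (const (+ 11)) c                  ≡⟨ total-* (+ 11) c ⟩
    + 11 * total c                        ∎)
    where open ≡-Reasoning

  -- Compare the squared lengths of `11 c′ + ρ` and `V c`, the latter being 121 times that of `c`.
  -- The constant 10 is `dot ρ ρ / 11`.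
  Neighbour-norm : ∀ {c c′} → Neighbour c c′ → + 11 * dot c′ c′ + + 2 * dot ρ c′ + + 10 ≡ + 11 * dot c c
  Neighbour-norm {c} {c′} nb = ℤ.*-cancelˡ-≡ (+ 11) (+ 11 * dot c′ c′ + + 2 * dot ρ c′ + + 10) (+ 11 * dot c c) (begin
    + 11 * (+ 11 * dot c′ c′ + + 2 * dot ρ c′ + + 10)
      ≡⟨ alg₁ (dot c′ c′) (dot ρ c′) ⟩
    + 121 * dot c′ c′ + + 22 * dot ρ c′ + + 110
      ≡⟨ cong₂ (λ x y → x + y + + 110) (total-* (+ 121) (λ i → c′ i * c′ i)) (total-* (+ 22) (λ i → ρ i * c′ i)) ⟨
    -- `dot ρ ρ` computes to 110.
    total (λ i → + 121 * (c′ i * c′ i)) + total (λ i → + 22 * (ρ i * c′ i)) + dot ρ ρ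
      ≡⟨ cong (_+ dot ρ ρ) (total-+ (λ i → + 121 * (c′ i * c′ i)) (λ i → + 22 * (ρ i * c′ i))) ⟨
    total (λ i → + 121 * (c′ i * c′ i) + + 22 * (ρ i * c′ i)) + dot ρ ρ
      ≡⟨ total-+ (λ i → + 121 * (c′ i * c′ i) + + 22 * (ρ i * c′ i)) (λ i → ρ i * ρ i) ⟨
    total (λ i → + 121 * (c′ i * c′ i) + + 22 * (ρ i * c′ i) + ρ i * ρ i)
      ≡⟨ total-cong (λ i → trans (alg₂ (c′ i) (ρ i)) (cong₂ _*_ (image nb i) (image nb i))) ⟩
    dot (mul V c) (mul V c)          ≡⟨ dot-V c (mul V c) ⟩
    dot c (mul V (mul V c))          ≡⟨ dot-cong (λ a → refl {x = c a}) (V-involutive c) ⟩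
    dot c (λ i → + 121 * c i)        ≡⟨ dot-*ʳ (+ 121) c c ⟩
    + 121 * dot c c                  ≡⟨ alg₃ (dot c c) ⟩
    + 11 * (+ 11 * dot c c)          ∎)
    where
    open ≡-Reasoning
    alg₁ : ∀ x y → + 11 * (+ 11 * x + + 2 * y + + 10) ≡ + 121 * x + + 22 * y + + 110
    alg₁ = ℤ-Solver.solve-∀
    alg₂ : ∀ c r → + 121 * (c * c) + + 22 * (r * c) + r * r ≡ (+ 11 * c + r) * (+ 11 * c + r)
    alg₂ = ℤ-Solver.solve-∀
    alg₃ : ∀ x → + 121 * x ≡ + 11 * (+ 11 * x)
    alg₃ = ℤ-Solver.solve-∀

  Neighbour-cong : ∀ {c d c′ d′} → (∀ i → c i ≡ d i) → (∀ i → c′ i ≡ d′ i) → Neighbour c c′ → Neighbour d d′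
  Neighbour-cong {c} {d} {c′} {d′} p q nb = neighbour λ i →
    trans (cong (λ z → + 11 * z + ρ i) (sym (q i))) (trans (image nb i) (mul-cong p i))

  Neighbour-uniqueʳ : ∀ {c c′ d′} → Neighbour c c′ → Neighbour c d′ → ∀ i → c′ i ≡ d′ i
  Neighbour-uniqueʳ {c} {c′} {d′} p q i = ℤ.*-cancelˡ-≡ (+ 11) (c′ i) (d′ i)
    (ℤ-Group.∙-cancelʳ (ρ i) (+ 11 * c′ i) (+ 11 * d′ i) (trans (image p i) (sym (image q i))))

  -- Applying `V` once more multiplies by 121, so `V` is injective.
  Neighbour-uniqueˡ : ∀ {c d c′} → Neighbour c c′ → Neighbour d c′ → ∀ i → c i ≡ d i
  Neighbour-uniqueˡ {c} {d} p q i = ℤ.*-cancelˡ-≡ (+ 121) (c i) (d i)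
    (trans (sym (V-involutive c i)) (trans (mul-cong (λ a → trans (sym (image p a)) (image q a)) i) (V-involutive d i)))

  -- On vectors of total 0 with `dot ρ c` congruent to 1, `V c` is congruent to `ρ` modulo 11 in
  -- every coordinate.
  forward : ∀ c k → total c ≡ + 0 → dot ρ c ≡ + 1 + + 11 * k → Σ (Point 11) (Neighbour c)
  forward c k sum0 eq = c′ , neighbour λ i → sym (begin
    mul V c i                                                  ≡⟨ V-expand c i ⟩
    + 2 * total c + ρ i * dot ρ c + + 11 * mul U c i
      ≡⟨ cong₂ (λ s r → + 2 * s + ρ i * r + + 11 * mul U c i) sum0 eq ⟩
    + 2 * + 0 + ρ i * (+ 1 + + 11 * k) + + 11 * mul U c i      ≡⟨ alg (ρ i) k (mul U c i) ⟩
    + 11 * (ρ i * k + mul U c i) + ρ i                         ∎)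
    where
    open ≡-Reasoning
    c′ : Point 11
    c′ i = ρ i * k + mul U c i
    alg : ∀ r k u → + 2 * + 0 + r * (+ 1 + + 11 * k) + + 11 * u ≡ + 11 * (r * k + u) + r
    alg = ℤ-Solver.solve-∀

  -- For total 0, `V (11 c′ + ρ)` equals `11 (ρ · c′ + 5) ρ + 121 (U c′ + ρ + μ)`. The hypothesis
  -- makes the first term divisible by 121, and the quotient is the preimage because the square of
  -- `V` is 121.
  backward : ∀ c′ k → total c′ ≡ + 0 → dot ρ c′ + + 5 ≡ + 11 * k → Σ (Point 11) (λ c → Neighbour c c′)
  backward c′ k sum0 eq = c , neighbour λ i → ℤ.*-cancelˡ-≡ (+ 121) (+ 11 * c′ i + ρ i) (mul V c i) (begin
    + 121 * (+ 11 * c′ i + ρ i)                ≡⟨ V-involutive (λ a → + 11 * c′ a + ρ a) i ⟨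
    mul V (mul V (λ a → + 11 * c′ a + ρ a)) i  ≡⟨ mul-cong 121c i ⟩
    mul V (λ a → + 121 * c a) i                ≡⟨ dot-*ʳ (+ 121) (V i) c ⟩
    + 121 * mul V c i                          ∎)
    where
    open ≡-Reasoning
    c : Point 11
    c a = ρ a * k + mul U c′ a + ρ a + μ a
    alg : ∀ r k u m d → d + + 5 ≡ + 11 * k →
      + 11 * (+ 2 * + 0 + r * d + + 11 * u) + (+ 2 * + 0 + r * + 110 + + 11 * (+ 6 * r + + 11 * m))
        ≡ + 121 * (r * k + u + r + m)
    alg r k u m d eq = begin
      + 11 * (+ 2 * + 0 + r * d + + 11 * u) + (+ 2 * + 0 + r * + 110 + + 11 * (+ 6 * r + + 11 * m))
        ≡⟨ alg₁ r u m d ⟩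
      + 11 * r * (d + + 5) + + 121 * (u + r + m)     ≡⟨ cong (λ z → + 11 * r * z + + 121 * (u + r + m)) eq ⟩
      + 11 * r * (+ 11 * k) + + 121 * (u + r + m)    ≡⟨ alg₂ r k u m ⟩
      + 121 * (r * k + u + r + m)                    ∎
      where
      alg₁ : ∀ r u m d → + 11 * (+ 2 * + 0 + r * d + + 11 * u) + (+ 2 * + 0 + r * + 110 + + 11 * (+ 6 * r + + 11 * m))
        ≡ + 11 * r * (d + + 5) + + 121 * (u + r + m)
      alg₁ = ℤ-Solver.solve-∀
      alg₂ : ∀ r k u m → + 11 * r * (+ 11 * k) + + 121 * (u + r + m) ≡ + 121 * (r * k + u + r + m)
      alg₂ = ℤ-Solver.solve-∀
    121c : ∀ a → mul V (λ b → + 11 * c′ b + ρ b) a ≡ + 121 * c a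
    121c a = begin
      mul V (λ b → + 11 * c′ b + ρ b) a        ≡⟨ dot-+ʳ (V a) (λ b → + 11 * c′ b) ρ ⟩
      mul V (λ b → + 11 * c′ b) a + mul V ρ a  ≡⟨ cong (_+ mul V ρ a) (dot-*ʳ (+ 11) (V a) c′) ⟩
      + 11 * mul V c′ a + mul V ρ a            ≡⟨ cong₂ (λ x y → + 11 * x + y) (V-expand c′ a) (V-expand ρ a) ⟩
      -- `total ρ` and `dot ρ ρ` compute to 0 and 110.
      + 11 * (+ 2 * total c′ + ρ a * dot ρ c′ + + 11 * mul U c′ a) + (+ 2 * + 0 + ρ a * + 110 + + 11 * mul U ρ a)
        ≡⟨ cong₂ (λ s u → + 11 * (+ 2 * s + ρ a * dot ρ c′ + + 11 * mul U c′ a) + (+ 2 * + 0 + ρ a * + 110 + + 11 * u)) sum0 (Uρ a) ⟩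
      + 11 * (+ 2 * + 0 + ρ a * dot ρ c′ + + 11 * mul U c′ a) + (+ 2 * + 0 + ρ a * + 110 + + 11 * (+ 6 * ρ a + + 11 * μ a))
        ≡⟨ alg (ρ a) k (mul U c′ a) (μ a) (dot ρ c′) eq ⟩
      + 121 * c a                              ∎

  -- Read off the coordinate of index 6, where ρ is 1.
  Neighbour-residue : ∀ {c c′} → Neighbour c c′ → total c ≡ + 0 → ∃ λ k → dot ρ c ≡ + 1 + + 11 * k
  Neighbour-residue {c} {c′} nb sum0 = c′ six - mul U c six , (begin
    dot ρ c                                    ≡⟨ alg₁ (dot ρ c) (mul U c six) ⟩
    + 2 * + 0 + ρ six * dot ρ c + + 11 * mul U c six - + 11 * mul U c six
      ≡⟨ cong (λ s → + 2 * s + ρ six * dot ρ c + + 11 * mul U c six - + 11 * mul U c six) sum0 ⟨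
    + 2 * total c + ρ six * dot ρ c + + 11 * mul U c six - + 11 * mul U c six
      ≡⟨ cong (_- + 11 * mul U c six) (trans (sym (V-expand c six)) (sym (image nb six))) ⟩
    + 11 * c′ six + + 1 - + 11 * mul U c six   ≡⟨ alg₂ (c′ six) (mul U c six) ⟩
    + 1 + + 11 * (c′ six - mul U c six)        ∎)
    where
    open ≡-Reasoning
    six : Fin 11
    six = # 6
    alg₁ : ∀ d u → d ≡ + 2 * + 0 + + 1 * d + + 11 * u - + 11 * u
    alg₁ = ℤ-Solver.solve-∀
    alg₂ : ∀ c u → + 11 * c + + 1 - + 11 * u ≡ + 1 + + 11 * (c - u)
    alg₂ = ℤ-Solver.solve-∀

open Lattice
open import Data.Nat.Base hiding (ℕ)
open import Data.Nat.Divisibility using (divides)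
open import Data.Nat.DivMod
open import Data.Nat.GeneralisedArithmetic using (fold; fold-+)
open import Data.Nat.Properties
open Algebra.Properties.CommutativeMonoid.Sum +-0-commutativeMonoid
  using (sum; sum-cong-≗; ∑-distrib-+; sum-replicate-zero)


-- Bijections between subtypes

Σ-≡ : {A : Set} {P : A → Set} → (∀ {a} → Irrelevant (P a)) →
  {x y : Σ A P} → proj₁ x ≡ proj₁ y → x ≡ y
Σ-≡ irr {a , p} {.a , q} refl = cong (a ,_) (irr p q)

subset-↔ : {A B : Set} {P : A → Set} {Q : B → Set} →
  (∀ {a} → Irrelevant (P a)) → (∀ {b} → Irrelevant (Q b)) →
  (to : Σ A P → Σ B Q) (from : Σ B Q → Σ A P) →
  (∀ x → proj₁ (from (to x)) ≡ proj₁ x) → (∀ y → proj₁ (to (from y)) ≡ proj₁ y) →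
  Σ A P ↔ Σ B Q
subset-↔ irrP irrQ to from ft tf =
  mk↔ₛ′ to from (λ y → Σ-≡ irrQ (tf y)) (λ x → Σ-≡ irrP (ft x))

bit : Bool → ℕ
bit true  = 1
bit false = 0

-- Finite sets of naturals

-- The list g₀ ∷ g₁ ∷ … encodes the set e₀ < e₁ < … with e₀ = g₀ and eᵢ₊₁ = eᵢ + 1 + gᵢ₊₁.
FinSet : Set
FinSet = List ℕ

-- Read as its characteristic sequence, a finite set is an eventually false stream of bits; `cons`,
-- `hd` and `tl` are the stream operations. The case `cons false []` keeps the code of the empty set
-- unique.
cons : Bool → FinSet → FinSet
cons true  f       = 0 ∷ f
cons false []      = []
cons false (g ∷ f) = suc g ∷ f

hd : FinSet → Bool
hd (0 ∷ _) = true
hd _       = false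

tl : FinSet → FinSet
tl []          = []
tl (0 ∷ f)     = f
tl (suc g ∷ f) = g ∷ f

hd-cons : ∀ b f → hd (cons b f) ≡ b
hd-cons true  f       = refl
hd-cons false []      = refl
hd-cons false (_ ∷ _) = refl

tl-cons : ∀ b f → tl (cons b f) ≡ f
tl-cons true  f       = refl
tl-cons false []      = refl
tl-cons false (_ ∷ _) = refl

cons-hd-tl : ∀ f → cons (hd f) (tl f) ≡ f
cons-hd-tl []          = refl
cons-hd-tl (0 ∷ f)     = refl
cons-hd-tl (suc g ∷ f) = refl

-- One more than the largest element, and 0 for the empty set.
size : FinSet → ℕ
size []      = 0
size (g ∷ f) = suc g + size f

size-tl : ∀ f → size (tl f) ≡ pred (size f)
size-tl []          = refl
size-tl (0 ∷ f)     = refl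
size-tl (suc g ∷ f) = refl

size≤0⇒[] : ∀ f → size f ≤ 0 → f ≡ []
size≤0⇒[] [] _ = refl

-- Translating `h` past each element undoes the relative coding, so this is the sum of `h` over the
-- set. All statistics below are instances of it.
wt : (ℕ → ℕ) → FinSet → ℕ
wt h []      = 0
wt h (g ∷ f) = h g + wt (λ x → h (suc g + x)) f

wt-cons : ∀ h b f → wt h (cons b f) ≡ bit b * h 0 + wt (h ∘ suc) f
wt-cons h true  f       = cong (_+ wt (h ∘ suc) f) (sym (*-identityˡ (h 0)))
wt-cons h false []      = refl
wt-cons h false (_ ∷ _) = refl

wt-cong : ∀ {h h′} → (∀ x → h x ≡ h′ x) → ∀ f → wt h f ≡ wt h′ f
wt-cong eq []      = refl
wt-cong eq (g ∷ f) = cong₂ _+_ (eq g) (wt-cong (eq ∘ (suc g +_)) f)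

wt-mono-≤ : ∀ {h h′} → (∀ x → h x ≤ h′ x) → ∀ f → wt h f ≤ wt h′ f
wt-mono-≤ le []      = z≤n
wt-mono-≤ le (g ∷ f) = +-mono-≤ (le g) (wt-mono-≤ (le ∘ (suc g +_)) f)

wt-+ : ∀ h h′ f → wt (λ x → h x + h′ x) f ≡ wt h f + wt h′ f
wt-+ h h′ []      = refl
wt-+ h h′ (g ∷ f) = trans
  (cong (h g + h′ g +_) (wt-+ (h ∘ (suc g +_)) (h′ ∘ (suc g +_)) f))
  (alg (h g) (h′ g) (wt (h ∘ (suc g +_)) f) (wt (h′ ∘ (suc g +_)) f))
  where
  alg : ∀ a b c d → a + b + (c + d) ≡ a + c + (b + d)
  alg = ℕ-Solver.solve-∀

wt-* : ∀ k h f → wt (λ x → k * h x) f ≡ k * wt h f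
wt-* k h []      = sym (*-zeroʳ k)
wt-* k h (g ∷ f) = trans (cong (k * h g +_) (wt-* k (h ∘ (suc g +_)) f))
  (sym (*-distribˡ-+ k (h g) _))

card : FinSet → ℕ
card = wt (const 1)

elementSum : FinSet → ℕ
elementSum = wt id

size≤wt-suc : ∀ f → size f ≤ wt suc f
size≤wt-suc []      = z≤n
size≤wt-suc (g ∷ f) = +-monoʳ-≤ (suc g)
  (≤-trans (size≤wt-suc f) (wt-mono-≤ (λ x → s≤s (m≤n+m x (suc g))) f))

-- The largest element alone accounts for the bound, since each element `x` adds `suc (h x)` to
-- `card f + wt h f`.
size-bound : ∀ k h → (∀ x → suc x ≤ k * suc (h x)) → ∀ f → size f ≤ k * (card f + wt h f)
size-bound k h le f = begin
  size f                       ≤⟨ size≤wt-suc f ⟩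
  wt suc f                     ≤⟨ wt-mono-≤ le f ⟩
  wt (λ x → k * suc (h x)) f   ≡⟨ wt-* k (suc ∘ h) f ⟩
  k * wt (suc ∘ h) f           ≡⟨ cong (k *_) (wt-+ (const 1) h f) ⟩
  k * (card f + wt h f)        ∎
  where open ≤-Reasoning

-- Blocks of consecutive positions

consB : ∀ {k} → Vec Bool k → FinSet → FinSet
consB []      f = f
consB (b ∷ v) f = cons b (consB v f)

takeB : ∀ k → FinSet → Vec Bool k
takeB zero    f = []
takeB (suc k) f = hd f ∷ takeB k (tl f)

dropB : ℕ → FinSet → FinSet
dropB zero    f = f
dropB (suc k) f = dropB k (tl f)

takeB-consB : ∀ {k} (v : Vec Bool k) f → takeB k (consB v f) ≡ v
takeB-consB []      f = refl
takeB-consB (b ∷ v) f = cong₂ _∷_ (hd-cons b _)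
  (trans (cong (takeB _) (tl-cons b _)) (takeB-consB v f))

dropB-consB : ∀ {k} (v : Vec Bool k) f → dropB k (consB v f) ≡ f
dropB-consB []      f = refl
dropB-consB {suc k} (b ∷ v) f = trans (cong (dropB k) (tl-cons b _)) (dropB-consB v f)

consB-takeB-dropB : ∀ k f → consB (takeB k f) (dropB k f) ≡ f
consB-takeB-dropB zero    f = refl
consB-takeB-dropB (suc k) f =
  trans (cong (cons (hd f)) (consB-takeB-dropB k (tl f))) (cons-hd-tl f)

dropB-[] : ∀ k → dropB k [] ≡ []
dropB-[] zero    = refl
dropB-[] (suc k) = dropB-[] k

takeB-[] : ∀ k → takeB k [] ≡ replicate k false
takeB-[] zero    = refl
takeB-[] (suc k) = cong (false ∷_) (takeB-[] k)

size-dropB : ∀ k f → size (dropB k f) ≡ size f ∸ k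
size-dropB zero    f = refl
size-dropB (suc k) f = trans (size-dropB k (tl f))
  (trans (cong (_∸ k) (size-tl f)) (lemma (size f)))
  where
  lemma : ∀ n → pred n ∸ k ≡ n ∸ suc k
  lemma zero    = 0∸n≡0 k
  lemma (suc n) = refl

wtB : ∀ {k} → (ℕ → ℕ) → Vec Bool k → ℕ
wtB h []      = 0
wtB h (b ∷ v) = bit b * h 0 + wtB (h ∘ suc) v

wt-consB : ∀ {k} h (v : Vec Bool k) f → wt h (consB v f) ≡ wtB h v + wt (λ x → h (k + x)) f
wt-consB h []      f = refl
wt-consB h (b ∷ v) f = trans (wt-cons h b (consB v f))
  (trans (cong (bit b * h 0 +_) (wt-consB (h ∘ suc) v f))
         (sym (+-assoc (bit b * h 0) _ _)))

wtB-sum : ∀ {k} h (v : Vec Bool k) → wtB h v ≡ sum (λ i → bit (lookup v i) * h (toℕ i))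
wtB-sum h []      = refl
wtB-sum h (b ∷ v) = cong (bit b * h 0 +_) (wtB-sum (h ∘ suc) v)

wtB-cong : ∀ {k} {h h′} → (∀ (i : Fin k) → h (toℕ i) ≡ h′ (toℕ i)) → ∀ (v : Vec Bool k) → wtB h v ≡ wtB h′ v
wtB-cong eq []      = refl
wtB-cong eq (b ∷ v) = cong₂ (λ x y → bit b * x + y) (eq Fin.zero) (wtB-cong (eq ∘ Fin.suc) v)

-- Splitting by residue classes

-- Entry `i` collects the `l` for which `l * k + i` lies in the set. The number `n` is fuel,
-- sufficient as soon as it reaches `size f`.
splitN : ∀ k → ℕ → FinSet → Vec FinSet k
splitN k zero    f = replicate k []
splitN k (suc n) f = zipWith cons (takeB k f) (splitN k n (dropB k f))

joinN : ∀ {k} → ℕ → Vec FinSet k → FinSet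
joinN zero    ys = []
joinN (suc n) ys = consB (Vec.map hd ys) (joinN n (Vec.map tl ys))

size-dropB-≤ : ∀ k .{{_ : NonZero k}} {n} f → size f ≤ suc n → size (dropB k f) ≤ n
size-dropB-≤ (suc k) {n} f le = begin
  size (dropB (suc k) f)  ≡⟨ size-dropB (suc k) f ⟩
  size f ∸ suc k          ≤⟨ ∸-mono le (s≤s (z≤n {k})) ⟩
  n                       ∎
  where open ≤-Reasoning

splitN-[] : ∀ k n → splitN k n [] ≡ replicate k []
splitN-[] k zero    = refl
splitN-[] k (suc n) rewrite takeB-[] k | dropB-[] k | splitN-[] k n = lemma k
  where
  lemma : ∀ k → zipWith cons (replicate k false) (replicate k []) ≡ replicate k []
  lemma zero    = refl
  lemma (suc k) = cong ([] ∷_) (lemma k)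

-- Independence of the fuel; `split` and `join` choose different amounts and are compared at a
-- common larger one.
splitN-stable : ∀ k .{{_ : NonZero k}} m n f → size f ≤ m → size f ≤ n → splitN k m f ≡ splitN k n f
splitN-stable k zero n f le _ with refl ← size≤0⇒[] f le = sym (splitN-[] k n)
splitN-stable k (suc m) zero f _ le with refl ← size≤0⇒[] f le = splitN-[] k (suc m)
splitN-stable k (suc m) (suc n) f le le′ = cong (zipWith cons (takeB k f))
  (splitN-stable k m n (dropB k f) (size-dropB-≤ k f le) (size-dropB-≤ k f le′))

joinN-splitN : ∀ k .{{_ : NonZero k}} n f → size f ≤ n → joinN n (splitN k n f) ≡ f
joinN-splitN k zero    f le = sym (size≤0⇒[] f le)
joinN-splitN k (suc n) f le = trans
  (cong₂ (λ v ys → consB v (joinN n ys)) (map-hd (takeB k f) _) (map-tl (takeB k f) _))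
  (trans (cong (consB (takeB k f)) (joinN-splitN k n (dropB k f) (size-dropB-≤ k f le)))
    (consB-takeB-dropB k f))
  where
  map-hd : ∀ {k} (v : Vec Bool k) ys → Vec.map hd (zipWith cons v ys) ≡ v
  map-hd []      []       = refl
  map-hd (b ∷ v) (y ∷ ys) = cong₂ _∷_ (hd-cons b y) (map-hd v ys)
  map-tl : ∀ {k} (v : Vec Bool k) ys → Vec.map tl (zipWith cons v ys) ≡ ys
  map-tl []      []       = refl
  map-tl (b ∷ v) (y ∷ ys) = cong₂ _∷_ (tl-cons b y) (map-tl v ys)

totalSize : ∀ {k} → Vec FinSet k → ℕ
totalSize []       = 0
totalSize (y ∷ ys) = size y + totalSize ys

size-lookup≤ : ∀ {k} (ys : Vec FinSet k) i → size (lookup ys i) ≤ totalSize ys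
size-lookup≤ (y ∷ ys) Fin.zero    = m≤m+n _ _
size-lookup≤ (y ∷ ys) (Fin.suc i) = ≤-trans (size-lookup≤ ys i) (m≤n+m _ (size y))

SizesBounded : ∀ {k} → ℕ → Vec FinSet k → Set
SizesBounded m ys = ∀ i → size (lookup ys i) ≤ m

SizesBounded-tl : ∀ {k m} (ys : Vec FinSet k) → SizesBounded (suc m) ys → SizesBounded m (Vec.map tl ys)
SizesBounded-tl ys le i rewrite lookup-map i tl ys | size-tl (lookup ys i) = pred-mono-≤ (le i)

SizesBounded-0 : ∀ {k} (ys : Vec FinSet k) → SizesBounded 0 ys → ys ≡ replicate k []
SizesBounded-0 []       le = refl
SizesBounded-0 (y ∷ ys) le = cong₂ _∷_ (size≤0⇒[] y (le Fin.zero)) (SizesBounded-0 ys (le ∘ Fin.suc))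

splitN-joinN : ∀ {k} m (ys : Vec FinSet k) → SizesBounded m ys → splitN k m (joinN m ys) ≡ ys
splitN-joinN zero    ys le = sym (SizesBounded-0 ys le)
splitN-joinN {k} (suc m) ys le
  rewrite takeB-consB (Vec.map hd ys) (joinN m (Vec.map tl ys))
        | dropB-consB (Vec.map hd ys) (joinN m (Vec.map tl ys))
        | splitN-joinN m (Vec.map tl ys) (SizesBounded-tl ys le)
  = hd-tl ys
  where
  hd-tl : ∀ {k} (ys : Vec FinSet k) → zipWith cons (Vec.map hd ys) (Vec.map tl ys) ≡ ys
  hd-tl []       = refl
  hd-tl (y ∷ ys) = cong₂ _∷_ (cons-hd-tl y) (hd-tl ys)

joinN-[] : ∀ k n → joinN n (replicate k []) ≡ []
joinN-[] k zero    = refl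
joinN-[] k (suc n) rewrite map-replicate tl [] k | map-replicate hd [] k | joinN-[] k n = lemma k
  where
  lemma : ∀ k → consB (replicate k false) [] ≡ []
  lemma zero    = refl
  lemma (suc k) = cong (cons false) (lemma k)

joinN-stable : ∀ {k} m n (ys : Vec FinSet k) → SizesBounded m ys → SizesBounded n ys →
  joinN m ys ≡ joinN n ys
joinN-stable {k} zero n ys le _ rewrite SizesBounded-0 ys le = sym (joinN-[] k n)
joinN-stable {k} (suc m) zero ys _ le rewrite SizesBounded-0 ys le = joinN-[] k (suc m)
joinN-stable (suc m) (suc n) ys le le′ = cong (consB (Vec.map hd ys))
  (joinN-stable m n (Vec.map tl ys) (SizesBounded-tl ys le) (SizesBounded-tl ys le′))

split : ∀ k → FinSet → Vec FinSet k
split k f = splitN k (size f) f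

join : ∀ {k} → Vec FinSet k → FinSet
join ys = joinN (totalSize ys) ys

split-join : ∀ {k} .{{_ : NonZero k}} (ys : Vec FinSet k) → split k (join ys) ≡ ys
split-join {k} ys = begin
  splitN k (size f) f       ≡⟨ splitN-stable k (size f) M f ≤-refl (m≤m+n _ _) ⟩
  splitN k M f              ≡⟨ cong (splitN k M) (joinN-stable (totalSize ys) M ys bd bdM) ⟩
  splitN k M (joinN M ys)   ≡⟨ splitN-joinN M ys bdM ⟩
  ys                        ∎
  where
  open ≡-Reasoning
  f = join ys
  M = size f + totalSize ys
  bd : SizesBounded (totalSize ys) ys
  bd = size-lookup≤ ys
  bdM : SizesBounded M ys
  bdM i = ≤-trans (bd i) (m≤n+m _ (size f))

join-split : ∀ k .{{_ : NonZero k}} f → join (split k f) ≡ f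
join-split k f = begin
  joinN (totalSize ys) ys   ≡⟨ joinN-stable (totalSize ys) M ys (size-lookup≤ ys)
                                 (λ i → ≤-trans (size-lookup≤ ys i) (m≤n+m _ (size f))) ⟩
  joinN M ys                ≡⟨ cong (joinN M) (splitN-stable k (size f) M f ≤-refl (m≤m+n _ _)) ⟩
  joinN M (splitN k M f)    ≡⟨ joinN-splitN k M f (m≤m+n _ _) ⟩
  f                         ∎
  where
  open ≡-Reasoning
  ys = split k f
  M = size f + totalSize ys

wt-splitN : ∀ k .{{_ : NonZero k}} h n f → size f ≤ n →
  wt h f ≡ sum (λ i → wt (λ l → h (l * k + toℕ i)) (lookup (splitN k n f) i))
wt-splitN k h zero    f le rewrite size≤0⇒[] f le = sym (trans
  (sum-cong-≗ {k} (λ i → cong (wt (λ l → h (l * k + toℕ i))) (lookup-replicate i [])))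
  (sum-replicate-zero k))
wt-splitN k h (suc n) f le = begin
  wt h f                                 ≡⟨ cong (wt h) (consB-takeB-dropB k f) ⟨
  wt h (consB v f′)                      ≡⟨ wt-consB h v f′ ⟩
  wtB h v + wt (λ x → h (k + x)) f′
    ≡⟨ cong₂ _+_ (wtB-sum h v) (wt-splitN k (λ x → h (k + x)) n f′ (size-dropB-≤ k f le)) ⟩
  sum (λ i → bit (lookup v i) * h (toℕ i)) +
    sum (λ i → wt (λ l → h (k + (l * k + toℕ i))) (lookup ys i))
    ≡⟨ ∑-distrib-+ {k} _ _ ⟨
  sum (λ i → bit (lookup v i) * h (toℕ i) + wt (λ l → h (k + (l * k + toℕ i))) (lookup ys i))
    ≡⟨ sum-cong-≗ step ⟩
  sum (λ i → wt (λ l → h (l * k + toℕ i)) (lookup (zipWith cons v ys) i))  ∎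
  where
  open ≡-Reasoning
  v = takeB k f
  f′ = dropB k f
  ys = splitN k n f′
  step : ∀ i → bit (lookup v i) * h (toℕ i) + wt (λ l → h (k + (l * k + toℕ i))) (lookup ys i)
    ≡ wt (λ l → h (l * k + toℕ i)) (lookup (zipWith cons v ys) i)
  step i = trans
    (cong (bit (lookup v i) * h (toℕ i) +_)
      (wt-cong (λ l → cong h (sym (+-assoc k (l * k) (toℕ i)))) (lookup ys i)))
    (trans (sym (wt-cons (λ l → h (l * k + toℕ i)) (lookup v i) (lookup ys i)))
      (cong (wt (λ l → h (l * k + toℕ i))) (sym (lookup-zipWith cons i v ys))))

wt-split : ∀ k .{{_ : NonZero k}} h f →
  wt h f ≡ sum (λ i → wt (λ l → h (l * k + toℕ i)) (lookup (split k f) i))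
wt-split k h f = wt-splitN k h (size f) f ≤-refl

-- Sorted lists

-- Gap e is the order of strict decrease for e = 1 and of weak decrease for e = 0.
Gap : ℕ → ℕ → ℕ → Set
Gap e a b = e + b ≤ a

-- The parameters `1 0` list the elements of a finite set; `0 1` list the parts of a partition from
-- the same code.
fromGaps : ℕ → ℕ → List ℕ → List ℕ
fromGaps e b []      = []
fromGaps e b (g ∷ f) = b + g ∷ fromGaps e (e + (b + g)) f

toGaps : ℕ → ℕ → List ℕ → List ℕ
toGaps e b []       = []
toGaps e b (x ∷ xs) = x ∸ b ∷ toGaps e (e + x) xs

Ascending : ℕ → ℕ → List ℕ → Set
Ascending e b []       = ⊤
Ascending e b (x ∷ xs) = b ≤ x × Ascending e (e + x) xs

toGaps-fromGaps : ∀ e b f → toGaps e b (fromGaps e b f) ≡ f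
toGaps-fromGaps e b []      = refl
toGaps-fromGaps e b (g ∷ f) = cong₂ _∷_ (m+n∸m≡n b g) (toGaps-fromGaps e _ f)

fromGaps-toGaps : ∀ e b xs → Ascending e b xs → fromGaps e b (toGaps e b xs) ≡ xs
fromGaps-toGaps e b []       _            = refl
fromGaps-toGaps e b (x ∷ xs) (b≤x , asc) rewrite m+[n∸m]≡n b≤x =
  cong (x ∷_) (fromGaps-toGaps e (e + x) xs asc)

fromGaps-ascending : ∀ e b f → Ascending e b (fromGaps e b f)
fromGaps-ascending e b []      = tt
fromGaps-ascending e b (g ∷ f) = m≤m+n b g , fromGaps-ascending e _ f

Ascending⇒All : ∀ e {b} xs → Ascending e b xs → All (b ≤_) xs
Ascending⇒All e []       _           = []
Ascending⇒All e (x ∷ xs) (b≤x , asc) =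
  b≤x ∷ All.map (≤-trans (≤-trans b≤x (m≤n+m x e))) (Ascending⇒All e xs asc)

module _ (e b : ℕ) where

  nextBound : List ℕ → ℕ
  nextBound []      = b
  nextBound (x ∷ _) = e + x

  -- Invariant of the accumulator: it is already ascending and begins far enough above the head of
  -- what remains.
  reverseAcc-ascending : ∀ xs {acc} → Linked (Gap e) xs → All (b ≤_) xs →
    Ascending e (nextBound xs) acc → Ascending e b (reverseAcc acc xs)
  reverseAcc-ascending []           _           _         asc = asc
  reverseAcc-ascending (x ∷ [])     _           (b≤x ∷ _) asc = b≤x , asc
  reverseAcc-ascending (x ∷ y ∷ xs) (gap ∷ lnk) (_ ∷ bds) asc =
    reverseAcc-ascending (y ∷ xs) lnk bds (gap , asc)

  reverseAcc-descending : ∀ xs {acc} → Ascending e (nextBound acc) xs → Linked (Gap e) acc →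
    Linked (Gap e) (reverseAcc acc xs)
  reverseAcc-descending []       _           lnk = lnk
  reverseAcc-descending (x ∷ xs) {[]}    (_ , asc)   lnk = reverseAcc-descending xs asc [-]
  reverseAcc-descending (x ∷ xs) {_ ∷ _} (gap , asc) lnk = reverseAcc-descending xs asc (gap ∷ lnk)

All-reverse : ∀ {P : ℕ → Set} {xs} → All P xs → All P (reverse xs)
All-reverse {xs = xs} = go xs []
  where
  go : ∀ {P : ℕ → Set} xs {acc} → All P acc → All P xs → All P (reverseAcc acc xs)
  go []       pacc _          = pacc
  go (x ∷ xs) pacc (px ∷ pxs) = go xs (px ∷ pacc) pxs

-- Rows and partitions put their largest entry first, while gaps are counted from the smallest.
descGaps : ℕ → ℕ → List ℕ → List ℕ
descGaps e b xs = toGaps e b (reverse xs)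

fromDescGaps : ℕ → ℕ → List ℕ → List ℕ
fromDescGaps e b f = reverse (fromGaps e b f)

fromDescGaps-linked : ∀ e b f → Linked (Gap e) (fromDescGaps e b f)
fromDescGaps-linked e b f = reverseAcc-descending e b (fromGaps e b f) (fromGaps-ascending e b f) []

fromDescGaps-bounded : ∀ e b f → All (b ≤_) (fromDescGaps e b f)
fromDescGaps-bounded e b f = All-reverse (Ascending⇒All e _ (fromGaps-ascending e b f))

descGaps-fromDescGaps : ∀ e b f → descGaps e b (fromDescGaps e b f) ≡ f
descGaps-fromDescGaps e b f =
  trans (cong (toGaps e b) (reverse-involutive (fromGaps e b f))) (toGaps-fromGaps e b f)

fromDescGaps-descGaps : ∀ e b {xs} → Linked (Gap e) xs → All (b ≤_) xs →
  fromDescGaps e b (descGaps e b xs) ≡ xs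
fromDescGaps-descGaps e b {xs} lnk bds = trans
  (cong reverse (fromGaps-toGaps e b (reverse xs) (reverseAcc-ascending e b xs lnk bds tt)))
  (reverse-involutive xs)

sum-map-reverse : ∀ {A : Set} (h : A → ℕ) xs → listSum (List.map h (reverse xs)) ≡ listSum (List.map h xs)
sum-map-reverse h xs = sum-↭ (map⁺ h (↭-reverse xs))

sum-fromGaps : ∀ h b f → listSum (List.map h (fromGaps 1 b f)) ≡ wt (λ x → h (b + x)) f
sum-fromGaps h b []      = refl
sum-fromGaps h b (g ∷ f) = cong (h (b + g) +_) (trans (sum-fromGaps h (suc (b + g)) f)
  (wt-cong (λ x → cong h (trans (cong suc (+-assoc b g x)) (sym (+-suc b (g + x))))) f))

length-fromGaps : ∀ e b f → length (fromGaps e b f) ≡ card f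
length-fromGaps e b []      = refl
length-fromGaps e b (g ∷ f) = cong suc (length-fromGaps e _ f)

-- Rows of Frobenius symbols

≺-irrelevant : ∀ {k} → Irrelevant₂ (_≺_ {k})
≺-irrelevant (inj₁ p) (inj₁ q) = cong inj₁ (<-irrelevant p q)
≺-irrelevant (inj₁ p) (inj₂ (eq , _)) = ⊥-elim (<-irrefl eq p)
≺-irrelevant (inj₂ (eq , _)) (inj₁ q) = ⊥-elim (<-irrefl eq q)
≺-irrelevant (inj₂ (p , p′)) (inj₂ (q , q′)) =
  cong inj₂ (cong₂ _,_ (≡-irrelevant p q) (<-irrelevant p′ q′))

module _ {k : ℕ} .{{_ : NonZero k}} where

  position : Colored k → ℕ
  position (l , c) = l * k + toℕ c

  colored : ℕ → Colored k
  colored x = x / k , x mod k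

  position-colored : ∀ x → position (colored x) ≡ x
  position-colored x = begin
    x / k * k + toℕ (x mod k)  ≡⟨ cong (x / k * k +_) (toℕ-fromℕ< (m%n<n x k)) ⟩
    x / k * k + x % k          ≡⟨ +-comm (x / k * k) (x % k) ⟩
    x % k + x / k * k          ≡⟨ m≡m%n+[m/n]*n x k ⟨
    x                          ∎
    where open ≡-Reasoning

  position-/ : ∀ l (c : Fin k) → (l * k + toℕ c) / k ≡ l
  position-/ l c = begin
    (l * k + toℕ c) / k      ≡⟨ +-distrib-/-∣ˡ (toℕ c) (divides l refl) ⟩
    l * k / k + toℕ c / k    ≡⟨ cong₂ _+_ (m*n/n≡m l k) (m<n⇒m/n≡0 (toℕ<n c)) ⟩
    l + 0                    ≡⟨ +-identityʳ l ⟩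
    l                        ∎
    where open ≡-Reasoning

  position-% : ∀ l (c : Fin k) → (l * k + toℕ c) % k ≡ toℕ c
  position-% l c = begin
    (l * k + toℕ c) % k   ≡⟨ cong (_% k) (+-comm (l * k) (toℕ c)) ⟩
    (toℕ c + l * k) % k   ≡⟨ [m+kn]%n≡m%n (toℕ c) l k ⟩
    toℕ c % k             ≡⟨ m<n⇒m%n≡m (toℕ<n c) ⟩
    toℕ c                 ∎
    where open ≡-Reasoning

  colored-position : ∀ x → colored (position x) ≡ x
  colored-position (l , c) = cong₂ _,_ (position-/ l c)
    (toℕ-injective (trans (toℕ-fromℕ< _) (position-% l c)))

  position-mono : ∀ {x y : Colored k} → x ≺ y → position x < position y
  position-mono {l , c} {l′ , c′} (inj₁ l<l′) = begin-strict
    l * k + toℕ c    <⟨ +-monoʳ-< (l * k) (toℕ<n c) ⟩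
    l * k + k        ≡⟨ +-comm (l * k) k ⟩
    suc l * k        ≤⟨ *-monoˡ-≤ k l<l′ ⟩
    l′ * k           ≤⟨ m≤m+n (l′ * k) (toℕ c′) ⟩
    l′ * k + toℕ c′  ∎
    where open ≤-Reasoning
  position-mono {l , c} (inj₂ (refl , c<c′)) = +-monoʳ-< (l * k) c<c′

  position-cancel : ∀ {x y : Colored k} → position x < position y → x ≺ y
  position-cancel {x} {y} lt with <-cmp (value x) (value y)
  ... | tri< l<l′ _ _ = inj₁ l<l′
  ... | tri> _ _ l>l′ = ⊥-elim (<-asym lt (position-mono {y} {x} (inj₁ l>l′)))
  ... | tri≈ _ refl _ = inj₂ (refl , +-cancelˡ-< (value x * k) _ _ lt)

  rowSet : List (Colored k) → FinSet
  rowSet xs = descGaps 1 0 (List.map position xs)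

  setRow : FinSet → List (Colored k)
  setRow f = List.map colored (fromDescGaps 1 0 f)

  map-position-setRow : ∀ f → List.map position (setRow f) ≡ fromDescGaps 1 0 f
  map-position-setRow f = trans (sym (map-∘ _))
    (trans (map-cong position-colored _) (map-id _))

  rowSet-setRow : ∀ f → rowSet (setRow f) ≡ f
  rowSet-setRow f = trans (cong (descGaps 1 0) (map-position-setRow f)) (descGaps-fromDescGaps 1 0 f)

  setRow-rowSet : ∀ {xs} → StrictlyDecreasing xs → setRow (rowSet xs) ≡ xs
  setRow-rowSet {xs} dec = begin
    List.map colored (fromDescGaps 1 0 (descGaps 1 0 (List.map position xs)))
      ≡⟨ cong (List.map colored) (fromDescGaps-descGaps 1 0
           (Linked.map⁺ (Linked.map position-mono dec)) (All.universal (λ _ → z≤n) _)) ⟩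
    List.map colored (List.map position xs)  ≡⟨ map-∘ xs ⟨
    List.map (colored ∘ position) xs         ≡⟨ map-cong colored-position xs ⟩
    List.map id xs                           ≡⟨ map-id xs ⟩
    xs                                       ∎
    where open ≡-Reasoning

  setRow-decreasing : ∀ f → StrictlyDecreasing (setRow f)
  setRow-decreasing f = Linked.map position-cancel (Linked.map⁻
    (subst (Linked (Gap 1)) (sym (map-position-setRow f)) (fromDescGaps-linked 1 0 f)))

  length-setRow : ∀ f → length (setRow f) ≡ card f
  length-setRow f = trans (length-map colored (fromDescGaps 1 0 f))
    (trans (length-reverse (fromGaps 1 0 f)) (length-fromGaps 1 0 f))

  values-setRow : ∀ f → listSum (List.map value (setRow f)) ≡ wt (_/ k) f
  values-setRow f = trans (cong listSum (sym (map-∘ (fromDescGaps 1 0 f))))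
    (trans (sum-map-reverse (_/ k) (fromGaps 1 0 f)) (sum-fromGaps (_/ k) 0 f))

×-irrelevant : {A B : Set} → Irrelevant A → Irrelevant B → Irrelevant (A × B)
×-irrelevant irrA irrB (a , b) (a′ , b′) = cong₂ _,_ (irrA a a′) (irrB b b′)

IsSymbol : (k : ℕ) .{{_ : NonZero k}} → ℕ → FinSet × FinSet → Set
IsSymbol k n (s , t) = card s ≡ card t × card s + (wt (_/ k) s + wt (_/ k) t) ≡ n

IsSymbol-irrelevant : ∀ k .{{_ : NonZero k}} {n m} → Irrelevant (IsSymbol k n m)
IsSymbol-irrelevant k = ×-irrelevant ≡-irrelevant ≡-irrelevant

module _ (k : ℕ) .{{_ : NonZero k}} (n : ℕ) where

  CFrob-≡ : {x y : CFrob k n} → FrobSymbol.top (proj₁ x) ≡ FrobSymbol.top (proj₁ y) →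
    FrobSymbol.bottom (proj₁ x) ≡ FrobSymbol.bottom (proj₁ y) → x ≡ y
  CFrob-≡ {record { top-dec = td ; bottom-dec = bd ; same-len = sl } , w}
          {record { top-dec = td′ ; bottom-dec = bd′ ; same-len = sl′ } , w′} refl refl
    with refl ← Linked.irrelevant ≺-irrelevant td td′
       | refl ← Linked.irrelevant ≺-irrelevant bd bd′
       | refl ← ≡-irrelevant sl sl′
       | refl ← ≡-irrelevant w w′ = refl

  CFrob↔Symbol : CFrob k n ↔ Σ (FinSet × FinSet) (IsSymbol k n)
  CFrob↔Symbol = mk↔ₛ′ to from
    (λ y → Σ-≡ {P = IsSymbol k n} (λ {m} → IsSymbol-irrelevant k {n} {m}) (cong₂ _,_ (rowSet-setRow {k} _) (rowSet-setRow {k} _)))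
    (λ x → CFrob-≡ (setRow-rowSet (FrobSymbol.top-dec (proj₁ x)))
                   (setRow-rowSet (FrobSymbol.bottom-dec (proj₁ x))))
    where
    open FrobSymbol
    card-rowSet : ∀ {xs : List (Colored k)} → StrictlyDecreasing xs → card (rowSet xs) ≡ length xs
    card-rowSet {xs} dec = trans (sym (length-setRow (rowSet xs))) (cong length (setRow-rowSet dec))
    wt-rowSet : ∀ {xs : List (Colored k)} → StrictlyDecreasing xs → wt (_/ k) (rowSet xs) ≡ listSum (List.map value xs)
    wt-rowSet {xs} dec = trans (sym (values-setRow (rowSet xs))) (cong (listSum ∘ List.map value) (setRow-rowSet dec))
    to : CFrob k n → Σ (FinSet × FinSet) (IsSymbol k n)
    to (x , w) = (rowSet (top x) , rowSet (bottom x)) ,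
      trans (card-rowSet (top-dec x)) (trans (same-len x) (sym (card-rowSet (bottom-dec x)))) ,
      trans (cong₂ _+_ (card-rowSet (top-dec x))
              (cong₂ _+_ (wt-rowSet (top-dec x)) (wt-rowSet (bottom-dec x)))) w
    from : Σ (FinSet × FinSet) (IsSymbol k n) → CFrob k n
    from ((s , t) , same , w) =
      record { top = setRow s ; bottom = setRow t
             ; top-dec = setRow-decreasing s ; bottom-dec = setRow-decreasing t
             ; same-len = trans (length-setRow {k} s) (trans same (sym (length-setRow {k} t))) } ,
      trans (cong₂ _+_ (length-setRow {k} s) (cong₂ _+_ (values-setRow s) (values-setRow t))) w

partSum : FinSet → ℕ
partSum f = listSum (fromGaps 0 1 f)

Partition-≡ : ∀ {n} {x y : Partition n} → Partition.parts x ≡ Partition.parts y → x ≡ y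
Partition-≡ {x = record { nonincr = d ; pos = a ; total = t }}
            {y = record { nonincr = d′ ; pos = a′ ; total = t′ }} refl
  with refl ← Linked.irrelevant ≤-irrelevant d d′
     | refl ← All.irrelevant ≤-irrelevant a a′
     | refl ← ≡-irrelevant t t′ = refl

-- Parts are weakly decreasing and at least 1, so arbitrary naturals occur as gaps and every code is
-- admissible.
Partition↔FinSet : ∀ n → Partition n ↔ Σ FinSet (λ f → partSum f ≡ n)
Partition↔FinSet n = mk↔ₛ′ to from
  (λ y → Σ-≡ ≡-irrelevant (descGaps-fromDescGaps 0 1 (proj₁ y)))
  (λ x → Partition-≡ (fromDescGaps-descGaps 0 1 (Partition.nonincr x) (Partition.pos x)))
  where
  sum-reverse : ∀ f → listSum (fromDescGaps 0 1 f) ≡ partSum f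
  sum-reverse f = sum-↭ (↭-reverse (fromGaps 0 1 f))
  to : Partition n → Σ FinSet (λ f → partSum f ≡ n)
  to record { parts = xs ; nonincr = d ; pos = a ; total = t } = descGaps 0 1 xs ,
    trans (sym (sum-reverse (descGaps 0 1 xs))) (trans (cong listSum (fromDescGaps-descGaps 0 1 d a)) t)
  from : Σ FinSet (λ f → partSum f ≡ n) → Partition n
  from (f , eq) = record
    { parts = fromDescGaps 0 1 f
    ; nonincr = fromDescGaps-linked 0 1 f
    ; pos = fromDescGaps-bounded 0 1 f
    ; total = trans (sum-reverse f) eq }

-- With parts counted upwards from rank 0, the element of `f` of rank r is the part minus 1 plus r.
-- The ranks contribute the odd numbers 1, 3, ..., whose sum is the square of `card f`.
partSum-wt : ∀ f → 2 * partSum f + card f * card f ≡ wt (λ x → suc (2 * suc x)) f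
partSum-wt f = trans (go 1 f) (trans (cong (_+ card f) (sym (wt-* 2 suc f)))
  (trans (sym (wt-+ (λ x → 2 * suc x) (const 1) f)) (wt-cong (λ x → +-comm (2 * suc x) 1) f)))
  where
  alg₁ : ∀ a s k → 2 * (a + s) + (1 + k) * (1 + k) ≡ 2 * a + (2 * s + k * k) + 2 * k + 1
  alg₁ = ℕ-Solver.solve-∀
  alg₂ : ∀ a w k → 2 * a + (2 * w + k) + 2 * k + 1 ≡ 2 * (a + (k + w)) + (1 + k)
  alg₂ = ℕ-Solver.solve-∀
  -- The lower bound 1 of the parts has to vary for the induction.
  go : ∀ b f → 2 * listSum (fromGaps 0 b f) + card f * card f ≡ 2 * wt (b +_) f + card f
  go b []      = refl
  go b (g ∷ f) = begin
    2 * (b + g + S) + suc k * suc k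
      ≡⟨ alg₁ (b + g) S k ⟩
    2 * (b + g) + (2 * S + k * k) + 2 * k + 1
      ≡⟨ cong (λ z → 2 * (b + g) + z + 2 * k + 1) (go (b + g) f) ⟩
    2 * (b + g) + (2 * w + k) + 2 * k + 1
      ≡⟨ alg₂ (b + g) w k ⟩
    2 * (b + g + (k + w)) + suc k
      ≡⟨ cong (λ z → 2 * (b + g + z) + suc k) (trans (sym (wt-+ (const 1) ((b + g) +_) f)) (wt-cong shift f)) ⟩
    2 * (b + g + wt (λ x → b + (suc g + x)) f) + suc k  ∎
    where
    open ≡-Reasoning
    k = card f
    S = listSum (fromGaps 0 (b + g) f)
    w = wt ((b + g) +_) f
    shift : ∀ x → 1 + (b + g + x) ≡ b + (suc g + x)
    shift x = trans (cong suc (+-assoc b g x)) (sym (+-suc b (g + x)))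

-- Maya diagrams

-- (s , t) has its particles at the half-integers l + 1/2 (l ∈ s) and its holes at -(l + 1/2) (l ∈ t).
Maya : Set
Maya = FinSet × FinSet

-- Only the position -1/2 crosses the origin; it carries a particle exactly if 0 is not among the
-- holes.
up : Maya → Maya
up (s , t) = cons (not (hd t)) s , tl t

down : Maya → Maya
down (s , t) = tl s , cons (not (hd s)) t

down-up : ∀ m → down (up m) ≡ m
down-up (s , t) rewrite tl-cons (not (hd t)) s | hd-cons (not (hd t)) s | not-involutive (hd t)
  | cons-hd-tl t = refl

up-down : ∀ m → up (down m) ≡ m
up-down (s , t) rewrite tl-cons (not (hd s)) t | hd-cons (not (hd s)) t | not-involutive (hd s)
  | cons-hd-tl s = refl

-- Twice the half-integer `l + 1/2`.
odd : ℕ → ℕ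
odd l = suc (2 * l)

twiceEnergy : Maya → ℕ
twiceEnergy (s , t) = wt odd s + wt odd t

charge : Maya → ℤ
charge (s , t) = pos (card s) ℤ.- pos (card t)

-- The shift of a diagram of charge c by one position raises twice its energy by 2 c + 1.
invariant : Maya → ℤ
invariant m = pos (twiceEnergy m) ℤ.- charge m ℤ.* charge m

card-cons : ∀ b f → card (cons b f) ≡ bit b + card f
card-cons b f = trans (wt-cons (const 1) b f) (cong (_+ card f) (*-identityʳ (bit b)))

wt-odd-cons : ∀ b f → wt odd (cons b f) ≡ bit b + (2 * card f + wt odd f)
wt-odd-cons b f = trans (wt-cons odd b f) (cong₂ _+_ (*-identityʳ (bit b)) (begin
  wt (odd ∘ suc) f                      ≡⟨ wt-cong (λ x → lemma x) f ⟩
  wt (λ x → 2 * 1 + odd x) f            ≡⟨ wt-+ (const 2) odd f ⟩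
  wt (const 2) f + wt odd f             ≡⟨ cong (_+ wt odd f) (wt-* 2 (const 1) f) ⟩
  2 * card f + wt odd f                 ∎))
  where
  open ≡-Reasoning
  lemma : ∀ x → 1 + 2 * (1 + x) ≡ 2 * 1 + (1 + 2 * x)
  lemma = ℕ-Solver.solve-∀

charge-up : ∀ m → charge (up m) ≡ ℤ.suc (charge m)
-- Writing `t` as `cons (hd t) (tl t)` exposes the crossing bit, and each of its two values leaves a
-- polynomial identity.
charge-up (s , t) = subst (λ t′ → charge (cons (not (hd t)) s , tl t) ≡ ℤ.suc (charge (s , t′))) (cons-hd-tl t)
  (lemma (hd t) (tl t))
  where
  lemma : ∀ b t → charge (cons (not b) s , t) ≡ ℤ.suc (charge (s , cons b t))
  lemma b t rewrite card-cons (not b) s | card-cons b t with b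
  ... | true  = alg (pos (card s)) (pos (card t))
    where
    alg : ∀ x y → x ℤ.- y ≡ pos 1 ℤ.+ (x ℤ.- (pos 1 ℤ.+ y))
    alg = ℤ-Solver.solve-∀
  ... | false = alg (pos (card s)) (pos (card t))
    where
    alg : ∀ x y → (pos 1 ℤ.+ x) ℤ.- y ≡ pos 1 ℤ.+ (x ℤ.- y)
    alg = ℤ-Solver.solve-∀

invariant-up : ∀ m → invariant (up m) ≡ invariant m
invariant-up (s , t) = subst (λ t′ → invariant (cons (not (hd t)) s , tl t) ≡ invariant (s , t′)) (cons-hd-tl t)
  (lemma (hd t) (tl t))
  where
  castˡ : ∀ b k x y → pos (bit b + (2 * k + x) + y) ≡
    pos (bit b) ℤ.+ (pos 2 ℤ.* pos k ℤ.+ pos x) ℤ.+ pos y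
  castˡ b k x y = cong (λ z → pos (bit b) ℤ.+ (z ℤ.+ pos x) ℤ.+ pos y) (ℤ.pos-* 2 k)
  castʳ : ∀ b k x y → pos (y + (bit b + (2 * k + x))) ≡
    pos y ℤ.+ (pos (bit b) ℤ.+ (pos 2 ℤ.* pos k ℤ.+ pos x))
  castʳ b k x y = cong (λ z → pos y ℤ.+ (pos (bit b) ℤ.+ (z ℤ.+ pos x))) (ℤ.pos-* 2 k)
  lemma : ∀ b t → invariant (cons (not b) s , t) ≡ invariant (s , cons b t)
  lemma b t rewrite card-cons (not b) s | card-cons b t | wt-odd-cons (not b) s | wt-odd-cons b t
    | castˡ (not b) (card s) (wt odd s) (wt odd t) | castʳ b (card t) (wt odd t) (wt odd s) with b
  ... | true  = alg (pos (card s)) (pos (card t)) (pos (wt odd s)) (pos (wt odd t))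
    where
    alg : ∀ x y u v → pos 0 ℤ.+ (pos 2 ℤ.* x ℤ.+ u) ℤ.+ v ℤ.- (pos 0 ℤ.+ x ℤ.- y) ℤ.* (pos 0 ℤ.+ x ℤ.- y)
      ≡ u ℤ.+ (pos 1 ℤ.+ (pos 2 ℤ.* y ℤ.+ v)) ℤ.- (x ℤ.- (pos 1 ℤ.+ y)) ℤ.* (x ℤ.- (pos 1 ℤ.+ y))
    alg = ℤ-Solver.solve-∀
  ... | false = alg (pos (card s)) (pos (card t)) (pos (wt odd s)) (pos (wt odd t))
    where
    alg : ∀ x y u v → pos 1 ℤ.+ (pos 2 ℤ.* x ℤ.+ u) ℤ.+ v ℤ.- (pos 1 ℤ.+ x ℤ.- y) ℤ.* (pos 1 ℤ.+ x ℤ.- y)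
      ≡ u ℤ.+ (pos 0 ℤ.+ (pos 2 ℤ.* y ℤ.+ v)) ℤ.- (x ℤ.- (pos 0 ℤ.+ y)) ℤ.* (x ℤ.- (pos 0 ℤ.+ y))
    alg = ℤ-Solver.solve-∀

charge-down : ∀ m → charge (down m) ≡ ℤ.pred (charge m)
charge-down m = trans (sym (ℤ.pred-suc (charge (down m))))
  (cong ℤ.pred (trans (sym (charge-up (down m))) (cong charge (up-down m))))

invariant-down : ∀ m → invariant (down m) ≡ invariant m
invariant-down m = trans (sym (invariant-up (down m))) (cong invariant (up-down m))

shift : ℤ → Maya → Maya
shift (pos zero)     m = m
shift (pos (suc n))  m = up (shift (pos n) m)
shift -[1+ zero ]    m = down m
shift -[1+ suc n ]   m = down (shift -[1+ n ] m)

invariant-shift : ∀ z m → invariant (shift z m) ≡ invariant m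
invariant-shift (pos zero)     m = refl
invariant-shift (pos (suc n))  m = trans (invariant-up (shift (pos n) m)) (invariant-shift (pos n) m)
invariant-shift -[1+ zero ]    m = invariant-down m
invariant-shift -[1+ suc n ]   m = trans (invariant-down (shift -[1+ n ] m)) (invariant-shift -[1+ n ] m)

charge-shift : ∀ z m → charge (shift z m) ≡ z ℤ.+ charge m
charge-shift (pos zero)    m = sym (ℤ.+-identityˡ (charge m))
charge-shift (pos (suc n)) m = trans (charge-up (shift (pos n) m))
  (trans (cong ℤ.suc (charge-shift (pos n) m)) (sym (ℤ.suc-+ n (charge m))))
charge-shift -[1+ zero ]   m = charge-down m
charge-shift -[1+ suc n ]  m = trans (charge-down (shift -[1+ n ] m))
  (trans (cong ℤ.pred (charge-shift -[1+ n ] m)) (sym (ℤ.+-assoc ℤ.-1ℤ -[1+ n ] (charge m))))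

shift-suc : ∀ z m → shift (ℤ.suc z) m ≡ up (shift z m)
shift-suc (pos n)       m = refl
shift-suc -[1+ zero ]   m = sym (up-down m)
shift-suc -[1+ suc n ]  m = sym (up-down (shift -[1+ n ] m))

shift-pred : ∀ z m → shift (ℤ.pred z) m ≡ down (shift z m)
shift-pred (pos zero)    m = refl
shift-pred (pos (suc n)) m = sym (down-up (shift (pos n) m))
shift-pred -[1+ n ]      m = refl

shift-+ : ∀ y z m → shift y (shift z m) ≡ shift (y ℤ.+ z) m
shift-+ (pos zero)    z m = cong (λ w → shift w m) (sym (ℤ.+-identityˡ z))
shift-+ (pos (suc n)) z m = trans (cong up (shift-+ (pos n) z m))
  (trans (sym (shift-suc (pos n ℤ.+ z) m)) (cong (λ w → shift w m) (sym (ℤ.suc-+ n z))))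
shift-+ -[1+ zero ]   z m = sym (shift-pred z m)
shift-+ -[1+ suc n ]  z m = trans (cong down (shift-+ -[1+ n ] z m))
  (trans (sym (shift-pred (-[1+ n ] ℤ.+ z) m)) (cong (λ w → shift w m) (sym (ℤ.+-assoc ℤ.-1ℤ -[1+ n ] z))))

-- Ordinary Frobenius symbols as neutral Maya diagrams, and partitions

IsFrobenius : ℕ → Maya → Set
IsFrobenius n (s , t) = card s ≡ card t × card s + (elementSum s + elementSum t) ≡ n

IsFrobenius-irrelevant : ∀ n {m} → Irrelevant (IsFrobenius n m)
IsFrobenius-irrelevant n = ×-irrelevant ≡-irrelevant ≡-irrelevant

wt-odd : ∀ f → wt odd f ≡ card f + 2 * elementSum f
wt-odd f = trans (wt-+ (const 1) (2 *_) f) (cong (card f +_) (wt-* 2 id f))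

charge-0⇒card : ∀ s t → charge (s , t) ≡ pos 0 → card s ≡ card t
charge-0⇒card s t eq = ℤ.+-injective (ℤ.i-j≡0⇒i≡j (pos (card s)) (pos (card t)) eq)

card⇒charge-0 : ∀ s t → card s ≡ card t → charge (s , t) ≡ pos 0
card⇒charge-0 s t eq = ℤ.i≡j⇒i-j≡0 (cong pos eq)

invariant-charge-0 : ∀ m → charge m ≡ pos 0 → invariant m ≡ pos (twiceEnergy m)
invariant-charge-0 m eq rewrite eq = ℤ.+-identityʳ _

twiceEnergy-card : ∀ s t → card s ≡ card t →
  twiceEnergy (s , t) ≡ 2 * (card s + (elementSum s + elementSum t))
twiceEnergy-card s t eq rewrite wt-odd s | wt-odd t | sym eq =
  alg (card s) (elementSum s) (elementSum t)
  where
  alg : ∀ k x y → k + 2 * x + (k + 2 * y) ≡ 2 * (k + (x + y))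
  alg = ℕ-Solver.solve-∀

-- In charge 0 the invariant is twice the energy, and the energy is the weight of the symbol. In
-- this form the weight survives shifts.
Frobenius⇒invariant : ∀ {n} m → IsFrobenius n m → charge m ≡ pos 0 × invariant m ≡ pos (2 * n)
Frobenius⇒invariant (s , t) (same , refl) = c0 ,
  trans (invariant-charge-0 (s , t) c0) (cong pos (twiceEnergy-card s t same))
  where c0 = card⇒charge-0 s t same

invariant⇒Frobenius : ∀ {n} m → charge m ≡ pos 0 → invariant m ≡ pos (2 * n) → IsFrobenius n m
invariant⇒Frobenius (s , t) c0 eq = same , *-cancelˡ-≡ _ _ 2
  (trans (sym (twiceEnergy-card s t same))
    (ℤ.+-injective (trans (sym (invariant-charge-0 (s , t) c0)) eq)))
  where same = charge-0⇒card s t c0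

-- With the strictly positive parts λ₁ ≥ … ≥ λ_k, the diagram with particles at λᵢ + k - i and no
-- holes has charge k; f lists the numbers λᵢ + k - i - 1.
filled : FinSet → Maya
filled f = cons false f , []

card-filled : ∀ f → card (cons false f) ≡ card f
card-filled f = card-cons false f

charge-filled : ∀ f → charge (filled f) ≡ pos (card f)
charge-filled f = trans (ℤ.+-identityʳ _) (cong pos (card-filled f))

invariant-filled : ∀ f → invariant (filled f) ≡ pos (2 * partSum f)
invariant-filled f = begin
  pos (wt odd (cons false f) + 0) ℤ.- c ℤ.* c
    ≡⟨ cong₂ (λ e c → pos e ℤ.- c ℤ.* c) energy (charge-filled f) ⟩
  pos (P + k * k) ℤ.- pos k ℤ.* pos k
    ≡⟨ cong (λ z → pos P ℤ.+ z ℤ.- pos k ℤ.* pos k) (ℤ.pos-* k k) ⟩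
  pos P ℤ.+ pos k ℤ.* pos k ℤ.- pos k ℤ.* pos k
    ≡⟨ alg (pos P) (pos k ℤ.* pos k) ⟩
  pos P ∎
  where
  open ≡-Reasoning
  k = card f
  P = 2 * partSum f
  c = charge (filled f)
  energy : wt odd (cons false f) + 0 ≡ P + k * k
  energy = trans (+-identityʳ _) (trans (wt-cons odd false f) (sym (partSum-wt f)))
  alg : ∀ x y → x ℤ.+ y ℤ.- y ≡ x
  alg = ℤ-Solver.solve-∀

-- `size` of the holes is the number of upward shifts after which the deepest hole has crossed the
-- origin.
holes-up : ∀ n m → size (proj₂ (shift (pos n) m)) ≡ size (proj₂ m) ∸ n
holes-up zero    m = refl
holes-up (suc n) m = trans (size-tl (proj₂ (shift (pos n) m)))
  (trans (cong pred (holes-up n m)) (pred[m∸n]≡m∸[1+n] (size (proj₂ m)) n))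

-- The first position of `filled f` is empty, so the first step down already creates a hole; every
-- later step deepens it by one.
holes-down : ∀ n f → size (proj₂ (shift -[1+ n ] (filled f))) ≡ suc n
holes-down zero    f rewrite hd-cons false f = refl
holes-down (suc n) f = size-cons (not (hd s)) t (holes-down n f)
  where
  s = proj₁ (shift -[1+ n ] (filled f))
  t = proj₂ (shift -[1+ n ] (filled f))
  size-cons : ∀ b t {n} → size t ≡ suc n → size (cons b t) ≡ suc (suc n)
  size-cons true  t       eq = cong suc eq
  size-cons false (_ ∷ _) eq = cong suc eq

holes-down′ : ∀ n f → size (proj₂ (shift (ℤ.- pos n) (filled f))) ≡ n
holes-down′ zero    f = refl
holes-down′ (suc n) f = holes-down n f

shift-inverse : ∀ y z m → y ℤ.+ z ≡ pos 0 → shift y (shift z m) ≡ m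
shift-inverse y z m eq = trans (shift-+ y z m) (cong (λ w → shift w m) eq)

-- The deepest hole is the last to cross the origin and then is the empty first position. Without
-- holes, charge 0 leaves no particles either.
filled-hd : ∀ s t → charge (s , t) ≡ pos 0 → hd (proj₁ (shift (pos (size t)) (s , t))) ≡ false
filled-hd s t c0 with size t in eq
... | zero with refl ← size≤0⇒[] t (≤-reflexive eq) = card-0 s (charge-0⇒card s t c0)
  where
  card-0 : ∀ s → card s ≡ 0 → hd s ≡ false
  card-0 [] _ = refl
... | suc n = trans (hd-cons _ _) (cong not (size-1 t′ (trans (holes-up n (s , t))
    (trans (cong (_∸ n) eq) (m+n∸n≡m 1 n)))))
  where
  t′ = proj₂ (shift (pos n) (s , t))
  size-1 : ∀ t → size t ≡ 1 → hd t ≡ true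
  size-1 (0 ∷ _) _ = refl

fill : ∀ s t → charge (s , t) ≡ pos 0 →
  Σ FinSet λ f → shift (pos (size t)) (s , t) ≡ filled f
fill s t c0 = tl s′ , cong₂ _,_
  (trans (sym (cons-hd-tl s′)) (cong (λ b → cons b (tl s′)) (filled-hd s t c0)))
  (size≤0⇒[] _ (≤-reflexive (trans (holes-up (size t) (s , t)) (n∸n≡0 (size t)))))
  where s′ = proj₁ (shift (pos (size t)) (s , t))

-- A partition with k parts is shifted down by k to charge 0. Conversely k is recovered as the depth
-- of the deepest hole, so shifting up by `size t` restores the diagram without holes.
FinSet↔Frobenius : ∀ n → Σ FinSet (λ f → partSum f ≡ n) ↔ Σ Maya (IsFrobenius n)
FinSet↔Frobenius n = subset-↔ ≡-irrelevant (λ {m} → IsFrobenius-irrelevant n {m}) to from from∘to to∘from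
  where
  unfill : FinSet → Maya
  unfill f = shift (ℤ.- pos (card f)) (filled f)

  to : Σ FinSet (λ f → partSum f ≡ n) → Σ Maya (IsFrobenius n)
  to (f , eq) = unfill f , invariant⇒Frobenius (unfill f)
    (trans (charge-shift (ℤ.- pos (card f)) (filled f))
      (trans (cong (λ c → ℤ.- pos (card f) ℤ.+ c) (charge-filled f)) (ℤ.+-inverseˡ (pos (card f)))))
    (trans (invariant-shift (ℤ.- pos (card f)) (filled f)) (trans (invariant-filled f) (cong (λ m → pos (2 * m)) eq)))

  from : Σ Maya (IsFrobenius n) → Σ FinSet (λ f → partSum f ≡ n)
  from ((s , t) , frob) = f , *-cancelˡ-≡ _ _ 2 (ℤ.+-injective (begin
    pos (2 * partSum f)                           ≡⟨ invariant-filled f ⟨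
    invariant (filled f)                          ≡⟨ cong invariant eq ⟨
    invariant (shift (pos (size t)) (s , t))      ≡⟨ invariant-shift (pos (size t)) (s , t) ⟩
    invariant (s , t)                             ≡⟨ proj₂ inv ⟩
    pos (2 * n)                                   ∎))
    where
    open ≡-Reasoning
    inv = Frobenius⇒invariant (s , t) frob
    f = proj₁ (fill s t (proj₁ inv))
    eq = proj₂ (fill s t (proj₁ inv))

  from∘to : ∀ x → proj₁ (from (to x)) ≡ proj₁ x
  from∘to (f , _) = trans (cong (tl ∘ proj₁) (begin
    shift (pos (size t)) (unfill f)         ≡⟨ cong (λ k → shift (pos k) (unfill f)) (holes-down′ (card f) f) ⟩
    shift (pos (card f)) (unfill f)         ≡⟨ shift-inverse (pos (card f)) (ℤ.- pos (card f)) (filled f)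
                                                 (ℤ.+-inverseʳ (pos (card f))) ⟩
    filled f                                ∎)) (tl-cons false f)
    where
    open ≡-Reasoning
    t = proj₂ (unfill f)

  to∘from : ∀ y → proj₁ (to (from y)) ≡ proj₁ y
  to∘from ((s , t) , frob) = begin
    shift (ℤ.- pos (card f)) (filled f)                      ≡⟨ cong (shift (ℤ.- pos (card f))) eq ⟨
    shift (ℤ.- pos (card f)) (shift (pos (size t)) (s , t))
      ≡⟨ shift-inverse (ℤ.- pos (card f)) (pos (size t)) (s , t)
           (trans (cong (λ k → ℤ.- k ℤ.+ pos (size t)) card-f) (ℤ.+-inverseˡ (pos (size t)))) ⟩
    (s , t)                                                  ∎
    where
    open ≡-Reasoning
    c0 = proj₁ (Frobenius⇒invariant (s , t) frob)
    f = proj₁ (fill s t c0)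
    eq = proj₂ (fill s t c0)
    card-f : pos (card f) ≡ pos (size t)
    card-f = begin
      pos (card f)                              ≡⟨ charge-filled f ⟨
      charge (filled f)                         ≡⟨ cong charge eq ⟨
      charge (shift (pos (size t)) (s , t))     ≡⟨ charge-shift (pos (size t)) (s , t) ⟩
      pos (size t) ℤ.+ charge (s , t)           ≡⟨ cong (λ c → pos (size t) ℤ.+ c) c0 ⟩
      pos (size t) ℤ.+ pos 0                    ≡⟨ ℤ.+-identityʳ _ ⟩
      pos (size t)                              ∎

-- Congruence modulo 11 and iterated maps

infix 4 _≈_
_≈_ : ℕ → ℕ → Set
a ≈ b = a % 11 ≡ b % 11

≈-+ : ∀ a b c d → a ≈ b → c ≈ d → a + c ≈ b + d
≈-+ a b c d p q = trans (%-distribˡ-+ a c 11)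
  (trans (cong₂ (λ x y → (x + y) % 11) p q) (sym (%-distribˡ-+ b d 11)))

≈-* : ∀ a b c d → a ≈ b → c ≈ d → a * c ≈ b * d
≈-* a b c d p q = trans (%-distribˡ-* a c 11)
  (trans (cong₂ (λ x y → (x * y) % 11) p q) (sym (%-distribˡ-* b d 11)))

fold-nested : ∀ {A : Set} (f : A → A) m n x → fold x (λ y → fold y f m) n ≡ fold x f (n * m)
fold-nested f m zero    x = refl
fold-nested f m (suc n) x = trans (cong (λ y → fold y f m) (fold-nested f m n x)) (sym (fold-+ x f m))

fold-id : ∀ {A : Set} (f : A → A) → (∀ x → f x ≡ x) → ∀ n x → fold x f n ≡ x
fold-id f f-id zero    x = refl
fold-id f f-id (suc n) x = trans (f-id _) (fold-id f f-id n x)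

-- Rotation of the colours within a level

Level : Set
Level = Vec Bool 11

count : ∀ {k} → Vec Bool k → ℕ
count = wtB (const 1)

colorSum : ∀ {k} → Vec Bool k → ℕ
colorSum = wtB id

-- Every colour is raised by 1, and the last one wraps around to 0.
rotate : ∀ {k} → Vec Bool (suc k) → Vec Bool (suc k)
rotate v = last v ∷ init v

wtB-∷ʳ : ∀ {k} h (v : Vec Bool k) b → wtB h (v ∷ʳ b) ≡ wtB h v + bit b * h k
wtB-∷ʳ h []      b = +-identityʳ _
wtB-∷ʳ h (x ∷ v) b = trans (cong (bit x * h 0 +_) (wtB-∷ʳ (h ∘ suc) v b)) (sym (+-assoc (bit x * h 0) _ _))

wtB-suc : ∀ {k} h (v : Vec Bool k) → wtB (suc ∘ h) v ≡ count v + wtB h v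
wtB-suc h []      = refl
wtB-suc h (b ∷ v) = trans (cong (bit b * suc (h 0) +_) (wtB-suc (h ∘ suc) v))
  (alg (bit b) (h 0) (count v) (wtB (h ∘ suc) v))
  where
  alg : ∀ b x c w → b * (1 + x) + (c + w) ≡ b * 1 + c + (b * x + w)
  alg = ℕ-Solver.solve-∀

count-rotate : ∀ {k} (v : Vec Bool (suc k)) → count (rotate v) ≡ count v
count-rotate v with initLast v
... | w , b , refl = trans (+-comm (bit b * 1) (count w)) (sym (wtB-∷ʳ (const 1) w b))

-- Each occupied colour gains 1, except that the last one, when it wraps, loses `suc k` in addition.
colorSum-rotate : ∀ {k} (v : Vec Bool (suc k)) →
  colorSum (rotate v) + bit (last v) * suc k ≡ colorSum v + count v
colorSum-rotate {k} v with initLast v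
... | w , b , refl rewrite wtB-∷ʳ id w b | wtB-∷ʳ (const 1) w b | wtB-suc id w =
  alg (bit b) (colorSum w) (count w) k
  where
  alg : ∀ b s c k → b * 0 + (c + s) + b * (1 + k) ≡ s + b * k + (c + b * 1)
  alg = ℕ-Solver.solve-∀

colorSum-rotate-≈ : ∀ (v : Level) → colorSum (rotate v) ≈ colorSum v + count v
colorSum-rotate-≈ v = trans (sym ([m+kn]%n≡m%n (colorSum (rotate v)) (bit (last v)) 11))
  (cong (_% 11) (colorSum-rotate v))

rotate¹¹ : ∀ (v : Level) → fold v rotate 11 ≡ v
rotate¹¹ (_ ∷ _ ∷ _ ∷ _ ∷ _ ∷ _ ∷ _ ∷ _ ∷ _ ∷ _ ∷ _ ∷ []) = refl

count-rotates : ∀ n (v : Level) → count (fold v rotate n) ≡ count v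
count-rotates zero    v = refl
count-rotates (suc n) v = trans (count-rotate (fold v rotate n)) (count-rotates n v)

colorSum-rotates : ∀ n (v : Level) → colorSum (fold v rotate n) ≈ n * count v + colorSum v
colorSum-rotates zero    v = refl
colorSum-rotates (suc n) v = begin
  colorSum (rotate w) % 11                 ≡⟨ colorSum-rotate-≈ w ⟩
  (colorSum w + count w) % 11              ≡⟨ ≈-+ (colorSum w) (n * count v + colorSum v) (count w) (count v)
                                                  (colorSum-rotates n v) (cong (_% 11) (count-rotates n v)) ⟩
  (n * count v + colorSum v + count v) % 11  ≡⟨ cong (_% 11) (alg n (count v) (colorSum v)) ⟩
  (suc n * count v + colorSum v) % 11      ∎
  where
  open ≡-Reasoning
  w = fold v rotate n
  alg : ∀ n c s → n * c + s + c ≡ (1 + n) * c + s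
  alg = ℕ-Solver.solve-∀

mixed : Level → Bool
mixed v = (0 <ᵇ count v) ∧ (count v <ᵇ 11)

-- By Fermat, the tenth power of `c` is 1 modulo 11 when 11 does not divide `c`.
inverse₁₁ : ℕ → ℕ
inverse₁₁ c = c ^ 9 % 11

inverse₁₁-correct : ∀ c → (0 <ᵇ c) ∧ (c <ᵇ 11) ≡ true → inverse₁₁ c * c ≈ 1
inverse₁₁-correct 1 _ = refl
inverse₁₁-correct 2 _ = refl
inverse₁₁-correct 3 _ = refl
inverse₁₁-correct 4 _ = refl
inverse₁₁-correct 5 _ = refl
inverse₁₁-correct 6 _ = refl
inverse₁₁-correct 7 _ = refl
inverse₁₁-correct 8 _ = refl
inverse₁₁-correct 9 _ = refl
inverse₁₁-correct 10 _ = refl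

-- Rotates by the number of steps that raises the colour sum by 1 modulo 11.
advance : Level → Level
advance v = fold v rotate (inverse₁₁ (count v))

count-advance : ∀ v → count (advance v) ≡ count v
count-advance v = count-rotates (inverse₁₁ (count v)) v

mixed-advance : ∀ v → mixed (advance v) ≡ mixed v
mixed-advance v = cong (λ c → (0 <ᵇ c) ∧ (c <ᵇ 11)) (count-advance v)

colorSum-advance : ∀ v → mixed v ≡ true → colorSum (advance v) ≈ 1 + colorSum v
colorSum-advance v mix = trans (colorSum-rotates (inverse₁₁ (count v)) v)
  (≈-+ (inverse₁₁ (count v) * count v) 1 (colorSum v) (colorSum v)
    (inverse₁₁-correct (count v) mix) refl)

-- Rotation keeps the count, so each application of `advance` uses the same number of rotations.
advance-iterate : ∀ n v → fold v advance n ≡ fold v (λ w → fold w rotate (inverse₁₁ (count v))) n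
advance-iterate zero    v = refl
advance-iterate (suc n) v = trans
  (cong (λ c → fold (fold v advance n) rotate (inverse₁₁ c)) (count-advances n))
  (cong (λ w → fold w rotate (inverse₁₁ (count v))) (advance-iterate n v))
  where
  count-advances : ∀ n → count (fold v advance n) ≡ count v
  count-advances zero    = refl
  count-advances (suc n) = trans (count-advance (fold v advance n)) (count-advances n)

advance¹¹ : ∀ v → fold v advance 11 ≡ v
advance¹¹ v = begin
  fold v advance 11                     ≡⟨ advance-iterate 11 v ⟩
  fold v (λ w → fold w rotate u) 11     ≡⟨ fold-nested rotate u 11 v ⟩
  fold v rotate (11 * u)                ≡⟨ cong (fold v rotate) (*-comm 11 u) ⟩
  fold v rotate (u * 11)                ≡⟨ fold-nested rotate 11 u v ⟨
  fold v (λ w → fold w rotate 11) u     ≡⟨ fold-id (λ w → fold w rotate 11) rotate¹¹ u v ⟩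
  v                                     ∎
  where
  open ≡-Reasoning
  u = inverse₁₁ (count v)

-- Rows as sequences of levels

fromLevels : ∀ {N} → Vec Level N → FinSet
fromLevels []      = []
fromLevels (v ∷ r) = consB v (fromLevels r)

toLevels : ∀ N → FinSet → Vec Level N
toLevels zero    f = []
toLevels (suc N) f = takeB 11 f ∷ toLevels N (dropB 11 f)

toLevels-fromLevels : ∀ {N} (r : Vec Level N) → toLevels N (fromLevels r) ≡ r
toLevels-fromLevels []          = refl
toLevels-fromLevels {suc N} (v ∷ r) = cong₂ _∷_ (takeB-consB v (fromLevels r))
  (trans (cong (toLevels N) (dropB-consB v (fromLevels r))) (toLevels-fromLevels r))

fromLevels-toLevels : ∀ N f → size f ≤ 11 * N → fromLevels (toLevels N f) ≡ f
fromLevels-toLevels zero    f le = sym (size≤0⇒[] f le)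
fromLevels-toLevels (suc N) f le = trans
  (cong (consB (takeB 11 f)) (fromLevels-toLevels N (dropB 11 f) size-le))
  (consB-takeB-dropB 11 f)
  where
  open ≤-Reasoning
  size-le : size (dropB 11 f) ≤ 11 * N
  size-le = begin
    size (dropB 11 f)   ≡⟨ size-dropB 11 f ⟩
    size f ∸ 11         ≤⟨ ∸-monoˡ-≤ 11 le ⟩
    11 * suc N ∸ 11     ≡⟨ cong (_∸ 11) (*-suc 11 N) ⟩
    11 + 11 * N ∸ 11    ≡⟨ m+n∸m≡n 11 (11 * N) ⟩
    11 * N              ∎

levelSum colors : FinSet → ℕ
levelSum = wt (_/ 11)
colors   = wt (_% 11)

wtB-0 : ∀ {k} (v : Vec Bool k) → wtB (const 0) v ≡ 0
wtB-0 []      = refl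
wtB-0 (b ∷ v) = trans (cong (_+ wtB (const 0) v) (*-zeroʳ (bit b))) (wtB-0 v)

card-∷ : ∀ {N} v (r : Vec Level N) → card (fromLevels (v ∷ r)) ≡ count v + card (fromLevels r)
card-∷ v r = wt-consB (const 1) v (fromLevels r)

-- Entries of the first level have value 0, and every entry of `r` is raised by one level.
levelSum-∷ : ∀ {N} v (r : Vec Level N) →
  levelSum (fromLevels (v ∷ r)) ≡ card (fromLevels r) + levelSum (fromLevels r)
levelSum-∷ v r = trans (wt-consB (_/ 11) v (fromLevels r)) (cong₂ _+_
  (trans (wtB-cong (λ i → m<n⇒m/n≡0 (toℕ<n i)) v) (wtB-0 v))
  (trans (wt-cong (λ x → +-distrib-/-∣ˡ {11} x {11} (divides 1 refl)) (fromLevels r))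
    (wt-+ (const 1) (_/ 11) (fromLevels r))))

colors-∷ : ∀ {N} v (r : Vec Level N) → colors (fromLevels (v ∷ r)) ≡ colorSum v + colors (fromLevels r)
colors-∷ v r = trans (wt-consB (_% 11) v (fromLevels r)) (cong₂ _+_
  (wtB-cong (λ i → m<n⇒m%n≡m (toℕ<n i)) v)
  (wt-cong (λ x → trans (cong (_% 11) (+-comm 11 x)) ([m+n]%n≡m%n x 11)) (fromLevels r)))

hasMixed : ∀ {N} → Vec Level N → Bool
hasMixed []      = false
hasMixed (v ∷ r) = if mixed v then true else hasMixed r

advanceRow : ∀ {N} → Vec Level N → Vec Level N
advanceRow []      = []
advanceRow (v ∷ r) = if mixed v then advance v ∷ r else v ∷ advanceRow r

card-advanceRow : ∀ {N} (r : Vec Level N) → card (fromLevels (advanceRow r)) ≡ card (fromLevels r)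
card-advanceRow []      = refl
card-advanceRow (v ∷ r) with mixed v
... | true  = trans (card-∷ (advance v) r) (trans (cong (_+ card (fromLevels r)) (count-advance v)) (sym (card-∷ v r)))
... | false = trans (card-∷ v (advanceRow r)) (trans (cong (count v +_) (card-advanceRow r)) (sym (card-∷ v r)))

levelSum-advanceRow : ∀ {N} (r : Vec Level N) → levelSum (fromLevels (advanceRow r)) ≡ levelSum (fromLevels r)
levelSum-advanceRow []      = refl
levelSum-advanceRow (v ∷ r) with mixed v
... | true  = trans (levelSum-∷ (advance v) r) (sym (levelSum-∷ v r))
... | false = trans (levelSum-∷ v (advanceRow r))
  (trans (cong₂ _+_ (card-advanceRow r) (levelSum-advanceRow r)) (sym (levelSum-∷ v r)))

colors-advanceRow : ∀ {N} (r : Vec Level N) → hasMixed r ≡ true →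
  colors (fromLevels (advanceRow r)) ≈ 1 + colors (fromLevels r)
colors-advanceRow (v ∷ r) mix with mixed v in eq
... | true  = begin
  colors (fromLevels (advance v ∷ r)) % 11           ≡⟨ cong (_% 11) (colors-∷ (advance v) r) ⟩
  (colorSum (advance v) + colors (fromLevels r)) % 11
    ≡⟨ ≈-+ (colorSum (advance v)) (1 + colorSum v) c c (colorSum-advance v eq) refl ⟩
  (1 + (colorSum v + colors (fromLevels r))) % 11    ≡⟨ cong (λ z → (1 + z) % 11) (colors-∷ v r) ⟨
  (1 + colors (fromLevels (v ∷ r))) % 11             ∎
  where
  open ≡-Reasoning
  c = colors (fromLevels r)
... | false = begin
  colors (fromLevels (v ∷ advanceRow r)) % 11               ≡⟨ cong (_% 11) (colors-∷ v (advanceRow r)) ⟩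
  (colorSum v + colors (fromLevels (advanceRow r))) % 11
    ≡⟨ ≈-+ (colorSum v) (colorSum v) (colors (fromLevels (advanceRow r))) (1 + c) refl (colors-advanceRow r mix) ⟩
  (colorSum v + (1 + colors (fromLevels r))) % 11           ≡⟨ cong (_% 11) (+-suc (colorSum v) c) ⟩
  (1 + (colorSum v + colors (fromLevels r))) % 11           ≡⟨ cong (λ z → (1 + z) % 11) (colors-∷ v r) ⟨
  (1 + colors (fromLevels (v ∷ r))) % 11                    ∎
  where
  open ≡-Reasoning
  c = colors (fromLevels r)

hasMixed-advanceRow : ∀ {N} (r : Vec Level N) → hasMixed (advanceRow r) ≡ hasMixed r
hasMixed-advanceRow []      = refl
hasMixed-advanceRow (v ∷ r) with mixed v in eq
... | true  rewrite mixed-advance v | eq = refl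
... | false rewrite eq = hasMixed-advanceRow r

-- A mixed level stays mixed under `advance`, so all iterates act on the same level.
advanceRow-iterate-mixed : ∀ {N} n v (r : Vec Level N) → mixed v ≡ true →
  mixed (fold v advance n) ≡ true × fold (v ∷ r) advanceRow n ≡ fold v advance n ∷ r
advanceRow-iterate-mixed zero    v r mix = mix , refl
advanceRow-iterate-mixed (suc n) v r mix with advanceRow-iterate-mixed n v r mix
... | mix′ , eq = trans (mixed-advance (fold v advance n)) mix′ ,
  trans (cong advanceRow eq) (cong (λ b → if b then advance (fold v advance n) ∷ r else fold v advance n ∷ advanceRow r) mix′)

advanceRow-iterate-unmixed : ∀ {N} n v (r : Vec Level N) → mixed v ≡ false →
  fold (v ∷ r) advanceRow n ≡ v ∷ fold r advanceRow n
advanceRow-iterate-unmixed zero    v r mix = refl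
advanceRow-iterate-unmixed (suc n) v r mix
  rewrite advanceRow-iterate-unmixed n v r mix | mix = refl

advanceRow¹¹ : ∀ {N} (r : Vec Level N) → fold r advanceRow 11 ≡ r
advanceRow¹¹ []      = refl
advanceRow¹¹ (v ∷ r) = by-cases (mixed v) refl
  where
  by-cases : ∀ b → mixed v ≡ b → fold (v ∷ r) advanceRow 11 ≡ v ∷ r
  by-cases true  eq = trans (proj₂ (advanceRow-iterate-mixed 11 v r eq)) (cong (_∷ r) (advance¹¹ v))
  by-cases false eq = trans (advanceRow-iterate-unmixed 11 v r eq) (cong (v ∷_) (advanceRow¹¹ r))

-- Orbits of a map of order eleven

≡ᵇ-irrelevant : ∀ {a b : Bool} → Irrelevant (a ≡ b)
≡ᵇ-irrelevant = Decidable⇒UIP.≡-irrelevant _≟ᵇ_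

module Cyclic {X : Set} (f : X → X) (f¹¹ : ∀ x → fold x f 11 ≡ x) (res : X → ℕ)
  (res< : ∀ x → res x < 11) (res-f : ∀ x → res (f x) ≡ suc (res x) % 11) where

  res-fold : ∀ n x → res (fold x f n) ≡ (n + res x) % 11
  res-fold zero    x = sym (m<n⇒m%n≡m (res< x))
  res-fold (suc n) x = begin
    res (f (fold x f n))            ≡⟨ res-f (fold x f n) ⟩
    suc (res (fold x f n)) % 11     ≡⟨ cong (λ r → suc r % 11) (res-fold n x) ⟩
    (1 + (n + res x) % 11) % 11     ≡⟨ ≈-+ 1 1 ((n + res x) % 11) (n + res x) refl (m%n%n≡m%n (n + res x) 11) ⟩
    (1 + (n + res x)) % 11          ∎
    where open ≡-Reasoning

  -- Returning from residue 1 to residue j would take j - 1 steps, which is negative for j = 0.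
  -- Using j + 10 steps instead makes the two directions add up to 22, again a multiple of 11.
  fold-22 : ∀ m n x → m + n ≡ 22 → fold (fold x f n) f m ≡ x
  fold-22 m n x eq = begin
    fold (fold x f n) f m           ≡⟨ fold-+ x f m ⟨
    fold x f (m + n)                ≡⟨ cong (fold x f) eq ⟩
    fold x f (11 + 11)              ≡⟨ fold-+ x f 11 {11} ⟩
    fold (fold x f 11) f 11         ≡⟨ f¹¹ (fold x f 11) ⟩
    fold x f 11                     ≡⟨ f¹¹ x ⟩
    x                               ∎
    where open ≡-Reasoning

  -- Each orbit meets every residue once, so an element is determined by its residue and the member
  -- of residue 1 in its orbit.
  orbits : X ↔ (Fin 11 × Σ X (λ x → res x ≡ 1))
  orbits = mk↔ₛ′ to from to∘from from∘to
    where
    to : X → Fin 11 × Σ X (λ x → res x ≡ 1)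
    -- The residue becomes 12, that is 1; `12 ∸ res x` is a true difference because residues are
    -- below 11.
    to x = fromℕ< (res< x) , fold x f (12 ∸ res x) ,
      trans (res-fold (12 ∸ res x) x) (cong (_% 11) (m∸n+n≡m (m≤n⇒m≤1+n (<⇒≤ (res< x)))))
    from : Fin 11 × Σ X (λ x → res x ≡ 1) → X
    from (j , x , _) = fold x f (toℕ j + 10)
    from∘to : ∀ x → from (to x) ≡ x
    from∘to x = fold-22 (toℕ (fromℕ< (res< x)) + 10) (12 ∸ res x) x (begin
      toℕ (fromℕ< (res< x)) + 10 + (12 ∸ res x)  ≡⟨ cong (λ r → r + 10 + (12 ∸ res x)) (toℕ-fromℕ< (res< x)) ⟩
      res x + 10 + (12 ∸ res x)                  ≡⟨ alg (res x) (12 ∸ res x) ⟩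
      10 + (12 ∸ res x + res x)                  ≡⟨ cong (10 +_) (m∸n+n≡m (m≤n⇒m≤1+n (<⇒≤ (res< x)))) ⟩
      22                                         ∎)
      where
      open ≡-Reasoning
      alg : ∀ r d → r + 10 + d ≡ 10 + (d + r)
      alg = ℕ-Solver.solve-∀
    to∘from : ∀ y → to (from y) ≡ y
    to∘from (j , x , res-x) = cong₂ _,_
      (toℕ-injective (trans (toℕ-fromℕ< _) res-y))
      (Σ-≡ ≡-irrelevant (trans (cong (fold y f) (cong (12 ∸_) res-y))
        (fold-22 (12 ∸ toℕ j) (toℕ j + 10) x
          (trans (alg (12 ∸ toℕ j) (toℕ j)) (cong (10 +_) (m∸n+n≡m (m≤n⇒m≤1+n (<⇒≤ (toℕ<n j)))))))))
      where
      open ≡-Reasoning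
      y = fold x f (toℕ j + 10)
      alg : ∀ d r → d + (r + 10) ≡ 10 + (d + r)
      alg = ℕ-Solver.solve-∀
      res-y : res y ≡ toℕ j
      res-y = begin
        res y                        ≡⟨ res-fold (toℕ j + 10) x ⟩
        (toℕ j + 10 + res x) % 11    ≡⟨ cong (λ r → (toℕ j + 10 + r) % 11) res-x ⟩
        (toℕ j + 10 + 1) % 11        ≡⟨ cong (_% 11) (+-assoc (toℕ j) 10 1) ⟩
        (toℕ j + 11) % 11            ≡⟨ [m+n]%n≡m%n (toℕ j) 11 ⟩
        toℕ j % 11                   ≡⟨ m<n⇒m%n≡m (toℕ<n j) ⟩
        toℕ j                        ∎

split-Bool : ∀ {A : Set} {P : A → Set} → (∀ {a} → Irrelevant (P a)) → (b : A → Bool) →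
  Σ A P ↔ (Σ A (λ a → P a × b a ≡ false) ⊎ Σ A (λ a → P a × b a ≡ true))
split-Bool {A} {P} irr b = mk↔ₛ′ (λ x → to x (b (proj₁ x)) refl) from to∘from (λ x → from∘to x (b (proj₁ x)) refl)
  where
  Target = Σ A (λ a → P a × b a ≡ false) ⊎ Σ A (λ a → P a × b a ≡ true)
  to : (x : Σ A P) (c : Bool) → b (proj₁ x) ≡ c → Target
  to (a , p) false eq = inj₁ (a , p , eq)
  to (a , p) true  eq = inj₂ (a , p , eq)
  from : Target → Σ A P
  from (inj₁ (a , p , _)) = a , p
  from (inj₂ (a , p , _)) = a , p
  from∘to : ∀ x c eq → from (to x c eq) ≡ x
  from∘to x false eq = refl
  from∘to x true  eq = refl
  to-eq : ∀ x c (eq : b (proj₁ x) ≡ c) c′ (eq′ : b (proj₁ x) ≡ c′) → to x c eq ≡ to x c′ eq′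
  to-eq x c refl .c refl = refl
  to∘from : ∀ y → to (from y) (b (proj₁ (from y))) refl ≡ y
  to∘from (inj₁ (a , p , eq)) = to-eq (a , p) _ refl false eq
  to∘from (inj₂ (a , p , eq)) = to-eq (a , p) _ refl true eq

-- Rotating a mixed level

Rows : ℕ → Set
Rows N = Vec Level N × Vec Level N

toSets : ∀ {N} → Rows N → FinSet × FinSet
toSets (S , T) = fromLevels S , fromLevels T

-- The factor 10 stands for -1 modulo 11.
residue : FinSet × FinSet → ℕ
residue (s , t) = (colors s + 10 * colors t) % 11

someMixed : ∀ {N} → Rows N → Bool
someMixed (S , T) = if hasMixed S then true else hasMixed T

-- The bottom row counts negatively: ten advances there lower its colour sum by 1 modulo 11 and so
-- raise the residue by 1.
advanceRows : ∀ {N} → Rows N → Rows N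
advanceRows (S , T) = if hasMixed S then (advanceRow S , T) else (S , fold T advanceRow 10)

hasMixed-iterate : ∀ {N} n (r : Vec Level N) → hasMixed (fold r advanceRow n) ≡ hasMixed r
hasMixed-iterate zero    r = refl
hasMixed-iterate (suc n) r = trans (hasMixed-advanceRow (fold r advanceRow n)) (hasMixed-iterate n r)

card-iterate : ∀ {N} n (r : Vec Level N) → card (fromLevels (fold r advanceRow n)) ≡ card (fromLevels r)
card-iterate zero    r = refl
card-iterate (suc n) r = trans (card-advanceRow (fold r advanceRow n)) (card-iterate n r)

levelSum-iterate : ∀ {N} n (r : Vec Level N) → levelSum (fromLevels (fold r advanceRow n)) ≡ levelSum (fromLevels r)
levelSum-iterate zero    r = refl
levelSum-iterate (suc n) r = trans (levelSum-advanceRow (fold r advanceRow n)) (levelSum-iterate n r)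

colors-iterate : ∀ {N} n (r : Vec Level N) → hasMixed r ≡ true →
  colors (fromLevels (fold r advanceRow n)) ≈ n + colors (fromLevels r)
colors-iterate zero    r mix = refl
colors-iterate (suc n) r mix = trans
  (colors-advanceRow (fold r advanceRow n) (trans (hasMixed-iterate n r) mix))
  (≈-+ 1 1 (colors (fromLevels (fold r advanceRow n))) (n + colors (fromLevels r)) refl (colors-iterate n r mix))

someMixed-advanceRows : ∀ {N} (x : Rows N) → someMixed (advanceRows x) ≡ someMixed x
someMixed-advanceRows (S , T) with hasMixed S in eq
... | true  rewrite hasMixed-advanceRow S | eq = refl
... | false rewrite eq = hasMixed-iterate 10 T

IsSymbol-advanceRows : ∀ {N n} (x : Rows N) → IsSymbol 11 n (toSets x) → IsSymbol 11 n (toSets (advanceRows x))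
IsSymbol-advanceRows (S , T) (same , w) with hasMixed S
... | true  = trans (card-advanceRow S) same ,
  trans (cong₂ _+_ (card-advanceRow S) (cong (_+ levelSum (fromLevels T)) (levelSum-advanceRow S))) w
... | false = trans same (sym (card-iterate 10 T)) ,
  trans (cong (λ l → card (fromLevels S) + (levelSum (fromLevels S) + l)) (levelSum-iterate 10 T)) w

residue-advanceRows : ∀ {N} (x : Rows N) → someMixed x ≡ true →
  residue (toSets (advanceRows x)) ≡ suc (residue (toSets x)) % 11
residue-advanceRows (S , T) mix with hasMixed S in eq
... | true  = begin
  (colors (fromLevels (advanceRow S)) + 10 * t) % 11
    ≡⟨ ≈-+ (colors (fromLevels (advanceRow S))) (1 + s) (10 * t) (10 * t) (colors-advanceRow S eq) refl ⟩
  (1 + (s + 10 * t)) % 11                        ≡⟨ ≈-+ 1 1 ((s + 10 * t) % 11) (s + 10 * t) refl (m%n%n≡m%n (s + 10 * t) 11) ⟨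
  (1 + (s + 10 * t) % 11) % 11                   ∎
  where
  open ≡-Reasoning
  s = colors (fromLevels S)
  t = colors (fromLevels T)
... | false = begin
  (s + 10 * colors (fromLevels (fold T advanceRow 10))) % 11
    ≡⟨ ≈-+ s s (10 * t′) (10 * (10 + t)) refl (≈-* 10 10 t′ (10 + t) refl (colors-iterate 10 T mix)) ⟩
  (s + 10 * (10 + t)) % 11                       ≡⟨ cong (_% 11) (alg s t) ⟩
  (1 + (s + 10 * t) + 9 * 11) % 11               ≡⟨ [m+kn]%n≡m%n (1 + (s + 10 * t)) 9 11 ⟩
  (1 + (s + 10 * t)) % 11                        ≡⟨ ≈-+ 1 1 ((s + 10 * t) % 11) (s + 10 * t) refl (m%n%n≡m%n (s + 10 * t) 11) ⟨
  (1 + (s + 10 * t) % 11) % 11                   ∎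
  where
  open ≡-Reasoning
  s = colors (fromLevels S)
  t = colors (fromLevels T)
  t′ = colors (fromLevels (fold T advanceRow 10))
  alg : ∀ s t → s + 10 * (10 + t) ≡ 1 + (s + 10 * t) + 9 * 11
  alg = ℕ-Solver.solve-∀

advanceRows¹¹ : ∀ {N} (x : Rows N) → fold x advanceRows 11 ≡ x
advanceRows¹¹ (S , T) = by-cases (hasMixed S) refl
  where
  iterate-top : ∀ n → hasMixed S ≡ true → fold (S , T) advanceRows n ≡ (fold S advanceRow n , T)
  iterate-top zero    eq = refl
  iterate-top (suc n) eq rewrite iterate-top n eq | hasMixed-iterate n S | eq = refl
  iterate-bottom : ∀ n → hasMixed S ≡ false →
    fold (S , T) advanceRows n ≡ (S , fold T (λ r → fold r advanceRow 10) n)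
  iterate-bottom zero    eq = refl
  iterate-bottom (suc n) eq rewrite iterate-bottom n eq | eq = refl
  by-cases : ∀ b → hasMixed S ≡ b → fold (S , T) advanceRows 11 ≡ (S , T)
  by-cases true  eq = trans (iterate-top 11 eq) (cong (_, T) (advanceRow¹¹ S))
  by-cases false eq = trans (iterate-bottom 11 eq) (cong (S ,_)
    (trans (fold-nested advanceRow 10 11 T)
      (trans (sym (fold-nested advanceRow 11 10 T)) (fold-id (λ r → fold r advanceRow 11) advanceRow¹¹ 10 T))))

-- Rows without mixed levels

count≤ : ∀ {k} (v : Vec Bool k) → count v ≤ k
count≤ []          = z≤n
count≤ (true  ∷ v) = s≤s (count≤ v)
count≤ (false ∷ v) = m≤n⇒m≤1+n (count≤ v)

empty-level : ∀ {k} (v : Vec Bool k) → count v ≡ 0 → v ≡ replicate k false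
empty-level []          _  = refl
empty-level (false ∷ v) eq = cong (false ∷_) (empty-level v eq)

full-level : ∀ {k} (v : Vec Bool k) → k ≤ count v → v ≡ replicate k true
full-level []          _        = refl
full-level (true  ∷ v) (s≤s le) = cong (true ∷_) (full-level v le)
full-level (false ∷ v) le       = ⊥-elim (<-irrefl refl (≤-trans le (count≤ v)))

unmixed-count : ∀ c → (0 <ᵇ c) ∧ (c <ᵇ 11) ≡ false → c ≡ 0 ⊎ 11 ≤ c
unmixed-count zero    _  = inj₁ refl
unmixed-count (suc c) eq = inj₂ (≮⇒≥ (λ lt → subst IsTrue eq (<⇒<ᵇ lt)))

unmixed-level : ∀ v → mixed v ≡ false → v ≡ replicate 11 (Vec.head v)
unmixed-level v eq with unmixed-count (count v) eq
... | inj₁ none = trans w (cong (λ u → replicate 11 (Vec.head u)) (sym w))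
  where w = empty-level v none
... | inj₂ all  = trans w (cong (λ u → replicate 11 (Vec.head u)) (sym w))
  where w = full-level v all

-- A full level has colour sum 55.
colorSum-replicate : ∀ b → colorSum (replicate 11 b) ≈ 0
colorSum-replicate true  = refl
colorSum-replicate false = refl

count-replicate : ∀ b → count (replicate 11 b) ≡ 11 * bit b
count-replicate true  = refl
count-replicate false = refl

mixed-replicate : ∀ b → mixed (replicate 11 b) ≡ false
mixed-replicate true  = refl
mixed-replicate false = refl

-- Meant for rows without mixed levels, where the eleven bits of a level agree and the first
-- represents them all.
contract : ∀ {N} → Vec Level N → FinSet
contract []      = []
contract (v ∷ r) = cons (Vec.head v) (contract r)

expand : ∀ N → FinSet → Vec Level N
expand zero    f = []
expand (suc N) f = replicate 11 (hd f) ∷ expand N (tl f)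

contract-expand : ∀ N f → size f ≤ N → contract (expand N f) ≡ f
contract-expand zero    f le = sym (size≤0⇒[] f le)
contract-expand (suc N) f le = trans
  (cong (cons (hd f)) (contract-expand N (tl f)
    (subst (_≤ N) (sym (size-tl f)) (pred-mono-≤ le))))
  (cons-hd-tl f)

unmixed-∷ : ∀ {N} v (r : Vec Level N) → hasMixed (v ∷ r) ≡ false → mixed v ≡ false × hasMixed r ≡ false
unmixed-∷ v r eq with mixed v
... | false = refl , eq

expand-contract : ∀ {N} (r : Vec Level N) → hasMixed r ≡ false → expand N (contract r) ≡ r
expand-contract []              _  = refl
expand-contract {suc N} (v ∷ r) eq = cong₂ _∷_
  (trans (cong (replicate 11) (hd-cons (Vec.head v) (contract r))) (sym (unmixed-level v (proj₁ (unmixed-∷ v r eq)))))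
  (trans (cong (expand N) (tl-cons (Vec.head v) (contract r))) (expand-contract r (proj₂ (unmixed-∷ v r eq))))

unmixed-expand : ∀ N f → hasMixed (expand N f) ≡ false
unmixed-expand zero    f = refl
unmixed-expand (suc N) f rewrite mixed-replicate (hd f) = unmixed-expand N (tl f)

colors-unmixed : ∀ {N} (r : Vec Level N) → hasMixed r ≡ false → colors (fromLevels r) ≈ 0
colors-unmixed []      _  = refl
colors-unmixed (v ∷ r) eq = trans (cong (_% 11) (colors-∷ v r))
  (≈-+ (colorSum v) 0 (colors (fromLevels r)) 0
    (trans (cong (λ v → colorSum v % 11) (unmixed-level v (proj₁ (unmixed-∷ v r eq)))) (colorSum-replicate (Vec.head v)))
    (colors-unmixed r (proj₂ (unmixed-∷ v r eq))))

card-unmixed : ∀ {N} (r : Vec Level N) → hasMixed r ≡ false → card (fromLevels r) ≡ 11 * card (contract r)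
card-unmixed []      _  = refl
card-unmixed (v ∷ r) eq = begin
  card (fromLevels (v ∷ r))                          ≡⟨ card-∷ v r ⟩
  count v + card (fromLevels r)                      ≡⟨ cong₂ _+_
    (trans (cong count (unmixed-level v (proj₁ (unmixed-∷ v r eq)))) (count-replicate b))
    (card-unmixed r (proj₂ (unmixed-∷ v r eq))) ⟩
  11 * bit b + 11 * card (contract r)                ≡⟨ *-distribˡ-+ 11 (bit b) (card (contract r)) ⟨
  11 * (bit b + card (contract r))                   ≡⟨ cong (11 *_) (card-cons b (contract r)) ⟨
  11 * card (cons b (contract r))                    ∎
  where
  open ≡-Reasoning
  b = Vec.head v

elementSum-cons : ∀ b f → elementSum (cons b f) ≡ card f + elementSum f
elementSum-cons b f = trans (wt-cons id b f) (cong₂ _+_ (*-zeroʳ (bit b)) (wt-+ (const 1) id f))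

levelSum-unmixed : ∀ {N} (r : Vec Level N) → hasMixed r ≡ false →
  levelSum (fromLevels r) ≡ 11 * elementSum (contract r)
levelSum-unmixed []      _  = refl
levelSum-unmixed (v ∷ r) eq = begin
  levelSum (fromLevels (v ∷ r))                            ≡⟨ levelSum-∷ v r ⟩
  card (fromLevels r) + levelSum (fromLevels r)            ≡⟨ cong₂ _+_ (card-unmixed r eq′) (levelSum-unmixed r eq′) ⟩
  11 * card (contract r) + 11 * elementSum (contract r)    ≡⟨ *-distribˡ-+ 11 (card (contract r)) (elementSum (contract r)) ⟨
  11 * (card (contract r) + elementSum (contract r))       ≡⟨ cong (11 *_) (elementSum-cons (Vec.head v) (contract r)) ⟨
  11 * elementSum (cons (Vec.head v) (contract r))         ∎
  where
  open ≡-Reasoning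
  eq′ = proj₂ (unmixed-∷ v r eq)

someMixed-false : ∀ {N} (S T : Vec Level N) → someMixed (S , T) ≡ false → hasMixed S ≡ false × hasMixed T ≡ false
someMixed-false S T eq with hasMixed S
... | false = refl , eq

someMixed-expand : ∀ N s t → someMixed (expand N s , expand N t) ≡ false
someMixed-expand N s t rewrite unmixed-expand N s = unmixed-expand N t

residue-unmixed : ∀ {N} (x : Rows N) → someMixed x ≡ false → residue (toSets x) ≡ 0
residue-unmixed (S , T) eq = ≈-+ (colors (fromLevels S)) 0 (10 * colors (fromLevels T)) (10 * 0)
  (colors-unmixed S (proj₁ un)) (≈-* 10 10 (colors (fromLevels T)) 0 refl (colors-unmixed T (proj₂ un)))
  where un = someMixed-false S T eq

-- The pair is the contracted one; its eleven-fold copy is the coloured symbol of weight `n`.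
IsFull : ℕ → FinSet × FinSet → Set
IsFull n (s , t) = card s ≡ card t × 11 * (card s + (elementSum s + elementSum t)) ≡ n

-- Decomposition of the 11-coloured symbols

suc≤11*suc/ : ∀ x → suc x ≤ 11 * suc (x / 11)
suc≤11*suc/ x = begin
  suc x                         ≡⟨ cong suc (m≡m%n+[m/n]*n x 11) ⟩
  suc (x % 11) + x / 11 * 11    ≤⟨ +-monoˡ-≤ (x / 11 * 11) (m%n<n x 11) ⟩
  11 + x / 11 * 11              ≡⟨ *-comm (suc (x / 11)) 11 ⟩
  11 * suc (x / 11)             ∎
  where open ≤-Reasoning

-- Bounds positions by the weight: with `c = 11`, a symbol of weight `n` fits into `n` levels; with
-- `c = 1`, its contraction fits into `n` bits.
symbol-bound : ∀ c h → (∀ x → suc x ≤ c * suc (h x)) → ∀ s t {n} → card s ≡ card t →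
  card s + (wt h s + wt h t) ≤ n → size s ≤ c * n × size t ≤ c * n
symbol-bound c h le s t {n} same w =
  ≤-trans (size-bound c h le s) (*-monoʳ-≤ c (≤-trans (+-monoʳ-≤ (card s) (m≤m+n (wt h s) (wt h t))) w)) ,
  ≤-trans (size-bound c h le t) (*-monoʳ-≤ c (≤-trans (subst (λ k → k + wt h t ≤ card s + (wt h s + wt h t)) same
    (+-monoʳ-≤ (card s) (m≤n+m (wt h t) (wt h s)))) w))

toRows : ∀ N → FinSet × FinSet → Rows N
toRows N (s , t) = toLevels N s , toLevels N t

toRows-toSets : ∀ {N} (x : Rows N) → toRows N (toSets x) ≡ x
toRows-toSets (S , T) = cong₂ _,_ (toLevels-fromLevels S) (toLevels-fromLevels T)

toSets-toRows : ∀ n m → IsSymbol 11 n m → toSets (toRows n m) ≡ m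
toSets-toRows n (s , t) (same , w) = cong₂ _,_ (fromLevels-toLevels n s (proj₁ bd)) (fromLevels-toLevels n t (proj₂ bd))
  where bd = symbol-bound 11 (_/ 11) suc≤11*suc/ s t same (≤-reflexive w)

IsFull-irrelevant : ∀ n {m} → Irrelevant (IsFull n m)
IsFull-irrelevant n = ×-irrelevant ≡-irrelevant ≡-irrelevant

module _ (n : ℕ) where

  RowSymbol : Rows n → Set
  RowSymbol x = IsSymbol 11 n (toSets x)

  RowSymbol-irrelevant : ∀ {x} → Irrelevant (RowSymbol x)
  RowSymbol-irrelevant {x} = IsSymbol-irrelevant 11 {n} {toSets x}

  Symbol↔RowSymbol : Σ (FinSet × FinSet) (IsSymbol 11 n) ↔ Σ (Rows n) RowSymbol
  Symbol↔RowSymbol = subset-↔ (λ {m} → IsSymbol-irrelevant 11 {n} {m}) (λ {x} → RowSymbol-irrelevant {x})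
    (λ (m , p) → toRows n m , subst (IsSymbol 11 n) (sym (toSets-toRows n m p)) p)
    (λ (x , p) → toSets x , p)
    (λ (m , p) → toSets-toRows n m p)
    (λ (x , p) → toRows-toSets x)

  Unmixed↔Full : Σ (Rows n) (λ x → RowSymbol x × someMixed x ≡ false) ↔ Σ (FinSet × FinSet) (IsFull n)
  Unmixed↔Full = subset-↔
    (λ {x} → ×-irrelevant (RowSymbol-irrelevant {x}) ≡ᵇ-irrelevant) (λ {m} → IsFull-irrelevant n {m})
    to from from∘to to∘from
    where
    to : Σ (Rows n) (λ x → RowSymbol x × someMixed x ≡ false) → Σ (FinSet × FinSet) (IsFull n)
    to ((S , T) , (same , w) , un) = (s , t) ,
      *-cancelˡ-≡ _ _ 11 (trans (sym cS) (trans same cT)) ,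
      trans (trans (*-distribˡ-+ 11 (card s) _) (cong (11 * card s +_) (*-distribˡ-+ 11 (elementSum s) (elementSum t))))
        (trans (cong₂ _+_ (sym cS) (cong₂ _+_ (sym (levelSum-unmixed S (proj₁ uns))) (sym (levelSum-unmixed T (proj₂ uns))))) w)
      where
      uns = someMixed-false S T un
      s = contract S
      t = contract T
      cS = card-unmixed S (proj₁ uns)
      cT = card-unmixed T (proj₂ uns)
    bound : ∀ s t → IsFull n (s , t) → size s ≤ n × size t ≤ n
    bound s t (same , w) = subst (λ k → size s ≤ k × size t ≤ k) (*-identityˡ n)
      (symbol-bound 1 id (λ x → ≤-reflexive (sym (*-identityˡ (suc x)))) s t same
        -- The weight of the contracted symbol is at most 11 times itself, which is `n`.
        (≤-trans (m≤n*m _ 11) (≤-reflexive w)))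
    from : Σ (FinSet × FinSet) (IsFull n) → Σ (Rows n) (λ x → RowSymbol x × someMixed x ≡ false)
    from ((s , t) , full@(same , w)) = (S , T) , (trans cS (trans (cong (11 *_) same) (sym cT)) ,
      trans (cong₂ _+_ cS (cong₂ _+_ lS lT))
        (trans (sym (trans (*-distribˡ-+ 11 (card s) _) (cong (11 * card s +_) (*-distribˡ-+ 11 (elementSum s) (elementSum t))))) w)) ,
      someMixed-expand n s t
      where
      S = expand n s
      T = expand n t
      bd = bound s t full
      es = contract-expand n s (proj₁ bd)
      et = contract-expand n t (proj₂ bd)
      cS = trans (card-unmixed S (unmixed-expand n s)) (cong (λ f → 11 * card f) es)
      cT = trans (card-unmixed T (unmixed-expand n t)) (cong (λ f → 11 * card f) et)
      lS = trans (levelSum-unmixed S (unmixed-expand n s)) (cong (λ f → 11 * elementSum f) es)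
      lT = trans (levelSum-unmixed T (unmixed-expand n t)) (cong (λ f → 11 * elementSum f) et)
    from∘to : ∀ x → proj₁ (from (to x)) ≡ proj₁ x
    from∘to ((S , T) , p , un) = cong₂ _,_ (expand-contract S (proj₁ uns)) (expand-contract T (proj₂ uns))
      where uns = someMixed-false S T un
    to∘from : ∀ y → proj₁ (to (from y)) ≡ proj₁ y
    to∘from ((s , t) , full) = cong₂ _,_ (contract-expand n s (proj₁ bd)) (contract-expand n t (proj₂ bd))
      where bd = bound s t full

  Mixed : Set
  Mixed = Σ (Rows n) (λ x → RowSymbol x × someMixed x ≡ true)

  Mixed-≡ : {x y : Mixed} → proj₁ x ≡ proj₁ y → x ≡ y
  Mixed-≡ = Σ-≡ (λ {x} → ×-irrelevant (RowSymbol-irrelevant {x}) ≡ᵇ-irrelevant)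

  advanceMixed : Mixed → Mixed
  advanceMixed (x , p , mix) = advanceRows x , IsSymbol-advanceRows x p , trans (someMixed-advanceRows x) mix

  advanceMixed-iterate : ∀ k x → proj₁ (fold x advanceMixed k) ≡ fold (proj₁ x) advanceRows k
  advanceMixed-iterate zero    x = refl
  advanceMixed-iterate (suc k) x = cong advanceRows (advanceMixed-iterate k x)

  IsUnitSymbol : FinSet × FinSet → Set
  IsUnitSymbol m = IsSymbol 11 n m × residue m ≡ 1

  IsUnitSymbol-irrelevant : ∀ {m} → Irrelevant (IsUnitSymbol m)
  IsUnitSymbol-irrelevant {m} = ×-irrelevant (IsSymbol-irrelevant 11 {n} {m}) ≡-irrelevant

  -- Symbols without mixed level have residue 0. Hence the orbit representatives of residue 1 can be
  -- described without reference to levels.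
  residue-1⇒mixed : ∀ (x : Rows n) → residue (toSets x) ≡ 1 → someMixed x ≡ true
  residue-1⇒mixed x res = by-cases (someMixed x) refl
    where
    by-cases : ∀ b → someMixed x ≡ b → someMixed x ≡ true
    by-cases true  eq = eq
    by-cases false eq = ⊥-elim (0≢1+n (trans (sym (residue-unmixed x eq)) res))

  UnitMixed↔UnitSymbol : Σ Mixed (λ x → residue (toSets (proj₁ x)) ≡ 1) ↔ Σ (FinSet × FinSet) IsUnitSymbol
  UnitMixed↔UnitSymbol = mk↔ₛ′ to from
    (λ (m , p , r) → Σ-≡ (λ {m} → IsUnitSymbol-irrelevant {m}) (toSets-toRows n m p))
    (λ ((x , p , mix) , r) → Σ-≡ ≡-irrelevant (Mixed-≡ (toRows-toSets x)))
    where
    to : Σ Mixed (λ x → residue (toSets (proj₁ x)) ≡ 1) → Σ (FinSet × FinSet) IsUnitSymbol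
    to ((x , p , _) , r) = toSets x , p , r
    from : Σ (FinSet × FinSet) IsUnitSymbol → Σ Mixed (λ x → residue (toSets (proj₁ x)) ≡ 1)
    from (m , p , r) = (toRows n m , subst (IsSymbol 11 n) eq p , residue-1⇒mixed (toRows n m) r′) , r′
      where
      eq = sym (toSets-toRows n m p)
      r′ = trans (cong residue (sym eq)) r

  open Cyclic advanceMixed
    (λ x → Mixed-≡ (trans (advanceMixed-iterate 11 x) (advanceRows¹¹ (proj₁ x))))
    (λ x → residue (toSets (proj₁ x)))
    (λ (x , _) → m%n<n (colors (fromLevels (proj₁ x)) + 10 * colors (fromLevels (proj₂ x))) 11)
    (λ (x , _ , mix) → residue-advanceRows x mix)
    using (orbits)

  Symbol-decomposition : Σ (FinSet × FinSet) (IsSymbol 11 n) ↔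
    (Σ (FinSet × FinSet) (IsFull n) ⊎ (Fin 11 × Σ (FinSet × FinSet) IsUnitSymbol))
  Symbol-decomposition = (Unmixed↔Full ⊎-↔ ((↔-id (Fin 11) ×-↔ UnitMixed↔UnitSymbol) ↔-∘ orbits))
    ↔-∘ (split-Bool (λ {x} → RowSymbol-irrelevant {x}) someMixed ↔-∘ Symbol↔RowSymbol)

-- Eleven Maya diagrams

Diagrams : Set
Diagrams = Vec Maya 11

charges : Diagrams → Point 11
charges y i = charge (lookup y i)

energies : Diagrams → Point 11
energies y i = pos (twiceEnergy (lookup y i))

-- Each diagram is first brought to charge 0 and then to the prescribed charge, so its
-- shift-invariant part is kept.
move : Point 11 → Diagrams → Diagrams
move c y = tabulate (λ i → shift (c i) (shift (ℤ.- charges y i) (lookup y i)))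

lookup-move : ∀ c y i → lookup (move c y) i ≡ shift (c i) (shift (ℤ.- charges y i) (lookup y i))
lookup-move c y = lookup∘tabulate (λ i → shift (c i) (shift (ℤ.- charges y i) (lookup y i)))

charges-move : ∀ c y i → charges (move c y) i ≡ c i
charges-move c y i = begin
  charge (lookup (move c y) i)                          ≡⟨ cong charge (lookup-move c y i) ⟩
  charge (shift (c i) (shift (ℤ.- q) (lookup y i)))     ≡⟨ charge-shift (c i) (shift (ℤ.- q) (lookup y i)) ⟩
  c i ℤ.+ charge (shift (ℤ.- q) (lookup y i))           ≡⟨ cong (λ z → c i ℤ.+ z) (charge-shift (ℤ.- q) (lookup y i)) ⟩
  c i ℤ.+ (ℤ.- q ℤ.+ q)                                 ≡⟨ cong (λ z → c i ℤ.+ z) (ℤ.+-inverseˡ q) ⟩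
  c i ℤ.+ pos 0                                         ≡⟨ ℤ.+-identityʳ (c i) ⟩
  c i                                                   ∎
  where
  open ≡-Reasoning
  q = charges y i

invariant-move : ∀ c y i → invariant (lookup (move c y) i) ≡ invariant (lookup y i)
invariant-move c y i = trans (cong invariant (lookup-move c y i))
  (trans (invariant-shift (c i) (shift (ℤ.- charges y i) (lookup y i))) (invariant-shift (ℤ.- charges y i) (lookup y i)))

move-move : ∀ c d y → (∀ i → d i ≡ charges y i) → move d (move c y) ≡ y
move-move c d y eq = trans (tabulate-cong step) (tabulate∘lookup y)
  where
  open ≡-Reasoning
  step : ∀ i → shift (d i) (shift (ℤ.- charges (move c y) i) (lookup (move c y) i)) ≡ lookup y i
  step i = begin
    shift (d i) (shift (ℤ.- charges (move c y) i) (lookup (move c y) i))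
      ≡⟨ cong₂ (λ z m → shift (d i) (shift (ℤ.- z) m)) (charges-move c y i) (lookup-move c y i) ⟩
    shift (d i) (shift (ℤ.- c i) (shift (c i) (shift (ℤ.- charges y i) (lookup y i))))
      ≡⟨ cong (shift (d i)) (shift-inverse (ℤ.- c i) (c i) (shift (ℤ.- charges y i) (lookup y i)) (ℤ.+-inverseˡ (c i))) ⟩
    shift (d i) (shift (ℤ.- charges y i) (lookup y i))
      ≡⟨ shift-inverse (d i) (ℤ.- charges y i) (lookup y i)
           (trans (cong (λ z → z ℤ.+ ℤ.- charges y i) (eq i)) (ℤ.+-inverseʳ (charges y i))) ⟩
    lookup y i ∎

total-energy : ∀ y → total (energies y) ≡ total (λ i → invariant (lookup y i)) ℤ.+ dot (charges y) (charges y)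
total-energy y = trans (total-cong (λ i → alg (energies y i) (charges y i)))
  (total-+ (λ i → invariant (lookup y i)) (λ i → charges y i ℤ.* charges y i))
  where
  alg : ∀ e c → e ≡ e ℤ.- c ℤ.* c ℤ.+ c ℤ.* c
  alg = ℤ-Solver.solve-∀

-- Doubled energy minus squared length of the charge vector is the sum of the invariants, which
-- moving preserves; the identity is stated without subtraction.
energy-move : ∀ c y → total (energies (move c y)) ℤ.+ dot (charges y) (charges y) ≡
  total (energies y) ℤ.+ dot c c
energy-move c y = begin
  total (energies y′) ℤ.+ dot (charges y) (charges y)
    ≡⟨ cong (λ e → e ℤ.+ dot (charges y) (charges y)) (total-energy y′) ⟩
  inv y′ ℤ.+ dot (charges y′) (charges y′) ℤ.+ dot (charges y) (charges y)
    ≡⟨ cong₂ (λ j d → j ℤ.+ d ℤ.+ dot (charges y) (charges y)) (total-cong (invariant-move c y))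
         (dot-cong (charges-move c y) (charges-move c y)) ⟩
  inv y ℤ.+ dot c c ℤ.+ dot (charges y) (charges y)
    ≡⟨ alg (inv y) (dot c c) (dot (charges y) (charges y)) ⟩
  inv y ℤ.+ dot (charges y) (charges y) ℤ.+ dot c c
    ≡⟨ cong (λ e → e ℤ.+ dot c c) (total-energy y) ⟨
  total (energies y) ℤ.+ dot c c ∎
  where
  open ≡-Reasoning
  y′ = move c y
  inv : Diagrams → ℤ
  inv y = total (λ i → invariant (lookup y i))
  alg : ∀ j c d → j ℤ.+ c ℤ.+ d ≡ j ℤ.+ d ℤ.+ c
  alg = ℤ-Solver.solve-∀

pos-sum : ∀ {n} (x : Fin n → ℕ) → pos (sum x) ≡ total (pos ∘ x)
pos-sum {zero}  x = refl
pos-sum {suc n} x = cong (λ z → pos (x Fin.zero) ℤ.+ z) (pos-sum (x ∘ Fin.suc))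

-- The involution π relabels the residue classes of the bottom row: in the Maya diagram of a
-- partition, the hole of depth 11 l + i lies in the same class as the particles 11 l + (10 - i).
module Classes (π : Fin 11 → Fin 11) (π-involutive : ∀ i → π (π i) ≡ i) where

  class : Maya → Fin 11 → Maya
  class (s , t) i = lookup (split 11 s) i , lookup (split 11 t) (π i)

  classes : Maya → Diagrams
  classes m = tabulate (class m)

  lookup-classes : ∀ m i → lookup (classes m) i ≡ class m i
  lookup-classes m = lookup∘tabulate (class m)

  tops bottoms : Diagrams → Vec FinSet 11
  tops y    = tabulate (λ i → proj₁ (lookup y i))
  bottoms y = tabulate (λ i → proj₂ (lookup y (π i)))

  unclasses : Diagrams → Maya
  unclasses y = join (tops y) , join (bottoms y)

  classes-unclasses : ∀ y → classes (unclasses y) ≡ y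
  classes-unclasses y = trans (tabulate-cong step) (tabulate∘lookup y)
    where
    step : ∀ i → class (unclasses y) i ≡ lookup y i
    step i = cong₂ _,_
      (trans (cong (λ v → lookup v i) (split-join (tops y))) (lookup∘tabulate (λ i → proj₁ (lookup y i)) i))
      (trans (cong (λ v → lookup v (π i)) (split-join (bottoms y)))
        (trans (lookup∘tabulate (λ i → proj₂ (lookup y (π i))) (π i)) (cong (λ j → proj₂ (lookup y j)) (π-involutive i))))

  unclasses-classes : ∀ m → unclasses (classes m) ≡ m
  unclasses-classes m@(s , t) = cong₂ _,_
    (trans (cong join (trans (tabulate-cong (λ i → cong proj₁ (lookup-classes m i))) (tabulate∘lookup (split 11 s))))
      (join-split 11 s))
    (trans (cong join (trans (tabulate-cong (λ i → trans (cong proj₂ (lookup-classes m (π i)))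
                                 (cong (lookup (split 11 t)) (π-involutive i))))
                             (tabulate∘lookup (split 11 t))))
      (join-split 11 t))

  top bottom : (ℕ → ℕ) → Maya → Point 11
  top h m i    = pos (wt (λ l → h (l * 11 + toℕ i)) (proj₁ (lookup (classes m) i)))
  bottom h m i = pos (wt (λ l → h (l * 11 + toℕ (π i))) (proj₂ (lookup (classes m) i)))

  top-total : ∀ h s t → pos (wt h s) ≡ total (top h (s , t))
  top-total h s t = trans (cong pos (wt-split 11 h s)) (trans (pos-sum x)
    (total-cong (λ i → cong (λ m → pos (wt (λ l → h (l * 11 + toℕ i)) (proj₁ m))) (sym (lookup-classes (s , t) i)))))
    where
    x : Fin 11 → ℕ
    x i = wt (λ l → h (l * 11 + toℕ i)) (lookup (split 11 s) i)

  bottom-total : ∀ h s t → pos (wt h t) ≡ total (bottom h (s , t))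
  bottom-total h s t = trans (cong pos (wt-split 11 h t)) (trans (pos-sum x)
    -- Class `i` holds the bottom residue `π i`, so the sum over residues is reindexed by `π`.
    (trans (ℤΣ.sum-permute {11} {11} (pos ∘ x) (permutation π π π-involutive π-involutive))
    (total-cong (λ i → cong (λ m → pos (wt (λ l → h (l * 11 + toℕ (π i))) (proj₂ m))) (sym (lookup-classes (s , t) i))))))
    where
    x : Fin 11 → ℕ
    x i = wt (λ l → h (l * 11 + toℕ i)) (lookup (split 11 t) i)

  difference-total : ∀ h s t → pos (wt h s) ℤ.- pos (wt h t) ≡ total (λ i → top h (s , t) i ℤ.- bottom h (s , t) i)
  difference-total h s t = begin
    pos (wt h s) ℤ.- pos (wt h t)             ≡⟨ cong₂ (λ x y → x ℤ.- y) (top-total h s t) (bottom-total h s t) ⟩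
    total x ℤ.- total y                       ≡⟨ cong (λ z → total x ℤ.+ z) (alg (total y)) ⟩
    total x ℤ.+ ℤ.-1ℤ ℤ.* total y             ≡⟨ cong (λ z → total x ℤ.+ z) (total-* ℤ.-1ℤ y) ⟨
    total x ℤ.+ total (λ i → ℤ.-1ℤ ℤ.* y i)   ≡⟨ total-+ x (λ i → ℤ.-1ℤ ℤ.* y i) ⟨
    total (λ i → x i ℤ.+ ℤ.-1ℤ ℤ.* y i)       ≡⟨ total-cong (λ i → cong (λ z → x i ℤ.+ z) (sym (alg (y i)))) ⟩
    total (λ i → x i ℤ.- y i)                 ∎
    where
    open ≡-Reasoning
    x = top h (s , t)
    y = bottom h (s , t)
    alg : ∀ x → ℤ.- x ≡ ℤ.-1ℤ ℤ.* x
    alg = ℤ-Solver.solve-∀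

  sum-total : ∀ h s t → pos (wt h s + wt h t) ≡ total (λ i → top h (s , t) i ℤ.+ bottom h (s , t) i)
  sum-total h s t = trans (cong₂ ℤ._+_ (top-total h s t) (bottom-total h s t))
    (sym (total-+ (top h (s , t)) (bottom h (s , t))))

  charge-total : ∀ m → charge m ≡ total (charges (classes m))
  charge-total (s , t) = difference-total (const 1) s t

wt-const : ∀ c f → wt (const c) f ≡ c * card f
wt-const c f = trans (wt-cong (λ _ → sym (*-identityʳ c)) f) (wt-* c (const 1) f)

-- Charge and energy of a diagram in terms of its eleven classes

module Straight = Classes id (λ _ → refl)
module Reversed = Classes opposite opposite-involutive

-- An entry of value l contributes `odd l` to the diagram of its colour; since the rows have equal
-- length, the units add up to twice that length.
straight-energy : ∀ s t → card s ≡ card t →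
  total (energies (Straight.classes (s , t))) ≡ pos (2 * (card s + (levelSum s + levelSum t)))
straight-energy s t same = begin
  total (energies y)
    ≡⟨ total-cong (λ i → cong₂ (λ a b → pos (a + b)) (level i (proj₁ (lookup y i))) (level i (proj₂ (lookup y i)))) ⟨
  total (λ i → Straight.top oddLevel (s , t) i ℤ.+ Straight.bottom oddLevel (s , t) i)
    ≡⟨ Straight.sum-total oddLevel s t ⟨
  pos (wt oddLevel s + wt oddLevel t)               ≡⟨ cong pos (cong₂ _+_ (expand-odd s) (expand-odd t)) ⟩
  pos (card s + 2 * levelSum s + (card t + 2 * levelSum t))
    ≡⟨ cong (λ k → pos (card s + 2 * levelSum s + (k + 2 * levelSum t))) same ⟨
  pos (card s + 2 * levelSum s + (card s + 2 * levelSum t))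
    ≡⟨ cong pos (alg (card s) (levelSum s) (levelSum t)) ⟩
  pos (2 * (card s + (levelSum s + levelSum t)))    ∎
  where
  open ≡-Reasoning
  y = Straight.classes (s , t)
  oddLevel : ℕ → ℕ
  oddLevel x = odd (x / 11)
  level : ∀ (i : Fin 11) f → wt (λ l → oddLevel (l * 11 + toℕ i)) f ≡ wt odd f
  level i f = wt-cong (λ l → cong odd (position-/ l i)) f
  expand-odd : ∀ f → wt oddLevel f ≡ card f + 2 * levelSum f
  expand-odd f = trans (wt-+ (const 1) (λ x → 2 * (x / 11)) f) (cong (card f +_) (wt-* 2 (_/ 11) f))
  alg : ∀ k x y → k + 2 * x + (k + 2 * y) ≡ 2 * (k + (x + y))
  alg = ℕ-Solver.solve-∀

-- Replacing the colour i by i - 5 changes the weighted sum by 5 times the total charge, which is 0.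
straight-colors : ∀ s t → total (charges (Straight.classes (s , t))) ≡ pos 0 →
  pos (colors s) ℤ.- pos (colors t) ≡ dot ρ (charges (Straight.classes (s , t)))
straight-colors s t sum0 = begin
  pos (colors s) ℤ.- pos (colors t)
    ≡⟨ Straight.difference-total (_% 11) s t ⟩
  total (λ i → Straight.top (_% 11) (s , t) i ℤ.- Straight.bottom (_% 11) (s , t) i)
    ≡⟨ total-cong (λ i → cong₂ (λ a b → a ℤ.- b) (color i (proj₁ (lookup y i))) (color i (proj₂ (lookup y i)))) ⟩
  total (λ i → pos (toℕ i) ℤ.* pos (card (proj₁ (lookup y i))) ℤ.- pos (toℕ i) ℤ.* pos (card (proj₂ (lookup y i))))
    ≡⟨ total-cong (λ i → alg (pos (toℕ i)) (pos (card (proj₁ (lookup y i)))) (pos (card (proj₂ (lookup y i))))) ⟩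
  total (λ i → ρ i ℤ.* charges y i ℤ.+ pos 5 ℤ.* charges y i)
    ≡⟨ total-+ (λ i → ρ i ℤ.* charges y i) (λ i → pos 5 ℤ.* charges y i) ⟩
  dot ρ (charges y) ℤ.+ total (λ i → pos 5 ℤ.* charges y i)
    ≡⟨ cong (λ z → dot ρ (charges y) ℤ.+ z) (trans (total-* (pos 5) (charges y)) (cong (λ z → pos 5 ℤ.* z) sum0)) ⟩
  dot ρ (charges y) ℤ.+ pos 0
    ≡⟨ ℤ.+-identityʳ (dot ρ (charges y)) ⟩
  dot ρ (charges y) ∎
  where
  open ≡-Reasoning
  y = Straight.classes (s , t)
  color : ∀ (i : Fin 11) f → pos (wt (λ l → (l * 11 + toℕ i) % 11) f) ≡ pos (toℕ i) ℤ.* pos (card f)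
  color i f = trans (cong pos (trans (wt-cong (λ l → position-% l i) f) (wt-const (toℕ i) f))) (ℤ.pos-* (toℕ i) (card f))
  alg : ∀ i x y → i ℤ.* x ℤ.- i ℤ.* y ≡ (i ℤ.- pos 5) ℤ.* (x ℤ.- y) ℤ.+ pos 5 ℤ.* (x ℤ.- y)
  alg = ℤ-Solver.solve-∀

-- A particle at 11 l + i + 1/2 has height 11 (l + 1/2) + ρᵢ. A hole of the same class has depth 11
-- l + (10 - i) + 1/2 = 11 (l + 1/2) - ρᵢ. Summing, the `ρ` terms are weighted by the charges.
reversed-energy : ∀ m → pos (twiceEnergy m) ≡
  pos 11 ℤ.* total (energies (Reversed.classes m)) ℤ.+ pos 2 ℤ.* dot ρ (charges (Reversed.classes m))
reversed-energy m@(s , t) = begin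
  pos (wt odd s + wt odd t)                           ≡⟨ Reversed.sum-total odd s t ⟩
  total (λ i → Reversed.top odd m i ℤ.+ Reversed.bottom odd m i)
    ≡⟨ total-cong step ⟩
  total (λ i → pos 11 ℤ.* energies y i ℤ.+ pos 2 ℤ.* (ρ i ℤ.* charges y i))
    ≡⟨ total-+ (λ i → pos 11 ℤ.* energies y i) (λ i → pos 2 ℤ.* (ρ i ℤ.* charges y i)) ⟩
  total (λ i → pos 11 ℤ.* energies y i) ℤ.+ total (λ i → pos 2 ℤ.* (ρ i ℤ.* charges y i))
    ≡⟨ cong₂ ℤ._+_ (total-* (pos 11) (energies y)) (total-* (pos 2) (λ i → ρ i ℤ.* charges y i)) ⟩
  pos 11 ℤ.* total (energies y) ℤ.+ pos 2 ℤ.* dot ρ (charges y) ∎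
  where
  open ≡-Reasoning
  y = Reversed.classes m
  -- The term `10 * card f` is twice the 5 in `ρ`, moved across the equation to stay in ℕ.
  odd-class : ∀ i f → wt (λ l → odd (l * 11 + i)) f + 10 * card f ≡ 11 * wt odd f + 2 * i * card f
  odd-class i f = begin
    wt (λ l → odd (l * 11 + i)) f + 10 * card f         ≡⟨ cong (wt (λ l → odd (l * 11 + i)) f +_) (wt-const 10 f) ⟨
    wt (λ l → odd (l * 11 + i)) f + wt (const 10) f     ≡⟨ wt-+ (λ l → odd (l * 11 + i)) (const 10) f ⟨
    wt (λ l → odd (l * 11 + i) + 10) f                  ≡⟨ wt-cong (λ l → alg l i) f ⟩
    wt (λ l → 11 * odd l + 2 * i) f                     ≡⟨ wt-+ (λ l → 11 * odd l) (const (2 * i)) f ⟩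
    wt (λ l → 11 * odd l) f + wt (const (2 * i)) f      ≡⟨ cong₂ _+_ (wt-* 11 odd f) (wt-const (2 * i) f) ⟩
    11 * wt odd f + 2 * i * card f                      ∎
    where
    alg : ∀ l i → 1 + 2 * (l * 11 + i) + 10 ≡ 11 * (1 + 2 * l) + 2 * i
    alg = ℕ-Solver.solve-∀
  odd-class-ℤ : ∀ i f → pos (wt (λ l → odd (l * 11 + i)) f) ≡
    pos 11 ℤ.* pos (wt odd f) ℤ.+ pos 2 ℤ.* (pos i ℤ.- pos 5) ℤ.* pos (card f)
  odd-class-ℤ i f = ℤ-Group.∙-cancelʳ (pos (10 * card f)) (pos (wt (λ l → odd (l * 11 + i)) f)) _ (begin
    pos (wt (λ l → odd (l * 11 + i)) f + 10 * card f)   ≡⟨ cong pos (odd-class i f) ⟩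
    pos (11 * wt odd f) ℤ.+ pos (2 * i * card f)
      ≡⟨ cong₂ ℤ._+_ (ℤ.pos-* 11 (wt odd f)) (trans (ℤ.pos-* (2 * i) (card f)) (cong (λ z → z ℤ.* pos (card f)) (ℤ.pos-* 2 i))) ⟩
    pos 11 ℤ.* pos (wt odd f) ℤ.+ pos 2 ℤ.* pos i ℤ.* pos (card f)
      ≡⟨ alg (pos (wt odd f)) (pos i) (pos (card f)) ⟩
    pos 11 ℤ.* pos (wt odd f) ℤ.+ pos 2 ℤ.* (pos i ℤ.- pos 5) ℤ.* pos (card f) ℤ.+ pos 10 ℤ.* pos (card f)
      ≡⟨ cong (λ z → pos 11 ℤ.* pos (wt odd f) ℤ.+ pos 2 ℤ.* (pos i ℤ.- pos 5) ℤ.* pos (card f) ℤ.+ z) (ℤ.pos-* 10 (card f)) ⟨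
    pos 11 ℤ.* pos (wt odd f) ℤ.+ pos 2 ℤ.* (pos i ℤ.- pos 5) ℤ.* pos (card f) ℤ.+ pos (10 * card f) ∎)
    where
    alg : ∀ w i k → pos 11 ℤ.* w ℤ.+ pos 2 ℤ.* i ℤ.* k ≡
      pos 11 ℤ.* w ℤ.+ pos 2 ℤ.* (i ℤ.- pos 5) ℤ.* k ℤ.+ pos 10 ℤ.* k
    alg = ℤ-Solver.solve-∀
  opposite-ρ : ∀ (i : Fin 11) → pos (toℕ (opposite i)) ℤ.- pos 5 ≡ ℤ.- ρ i
  opposite-ρ i = begin
    pos (toℕ (opposite i)) ℤ.- pos 5                                ≡⟨ alg (pos (toℕ (opposite i))) (pos (toℕ i)) ⟩
    pos (toℕ (opposite i) + toℕ i) ℤ.- pos 10 ℤ.- ρ i              ≡⟨ cong (λ k → pos k ℤ.- pos 10 ℤ.- ρ i) sum10 ⟩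
    pos 10 ℤ.- pos 10 ℤ.- ρ i                                       ≡⟨ ℤ.+-identityˡ (ℤ.- ρ i) ⟩
    ℤ.- ρ i                                                         ∎
    where
    sum10 : toℕ (opposite i) + toℕ i ≡ 10
    sum10 = trans (cong (_+ toℕ i) (opposite-prop i)) (m∸n+n≡m (≤-pred (toℕ<n i)))
    alg : ∀ j i → j ℤ.- pos 5 ≡ j ℤ.+ i ℤ.- pos 10 ℤ.- (i ℤ.- pos 5)
    alg = ℤ-Solver.solve-∀
  step : ∀ i → Reversed.top odd m i ℤ.+ Reversed.bottom odd m i ≡
    pos 11 ℤ.* energies y i ℤ.+ pos 2 ℤ.* (ρ i ℤ.* charges y i)
  step i = begin
    Reversed.top odd m i ℤ.+ Reversed.bottom odd m i
      ≡⟨ cong₂ ℤ._+_ (odd-class-ℤ (toℕ i) x) (trans (odd-class-ℤ (toℕ (opposite i)) z)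
           (cong (λ r → pos 11 ℤ.* pos (wt odd z) ℤ.+ pos 2 ℤ.* r ℤ.* pos (card z)) (opposite-ρ i))) ⟩
    pos 11 ℤ.* pos (wt odd x) ℤ.+ pos 2 ℤ.* ρ i ℤ.* pos (card x) ℤ.+
      (pos 11 ℤ.* pos (wt odd z) ℤ.+ pos 2 ℤ.* (ℤ.- ρ i) ℤ.* pos (card z))
      ≡⟨ alg (ρ i) (pos (wt odd x)) (pos (wt odd z)) (pos (card x)) (pos (card z)) ⟩
    pos 11 ℤ.* (pos (wt odd x) ℤ.+ pos (wt odd z)) ℤ.+ pos 2 ℤ.* (ρ i ℤ.* (pos (card x) ℤ.- pos (card z))) ∎
    where
    x = proj₁ (lookup y i)
    z = proj₂ (lookup y i)
    alg : ∀ r u v a b → pos 11 ℤ.* u ℤ.+ pos 2 ℤ.* r ℤ.* a ℤ.+ (pos 11 ℤ.* v ℤ.+ pos 2 ℤ.* (ℤ.- r) ℤ.* b)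
      ≡ pos 11 ℤ.* (u ℤ.+ v) ℤ.+ pos 2 ℤ.* (r ℤ.* (a ℤ.- b))
    alg = ℤ-Solver.solve-∀

residue⇒ : ∀ a b → (a + 10 * b) % 11 ≡ 1 → ∃ λ k → pos a ℤ.- pos b ≡ pos 1 ℤ.+ pos 11 ℤ.* k
residue⇒ a b eq = pos q ℤ.- pos b , (begin
  pos a ℤ.- pos b                                       ≡⟨ alg (pos a) (pos b) ⟩
  pos a ℤ.+ pos 10 ℤ.* pos b ℤ.- pos 11 ℤ.* pos b       ≡⟨ cong (λ z → pos a ℤ.+ z ℤ.- pos 11 ℤ.* pos b) (ℤ.pos-* 10 b) ⟨
  pos (a + 10 * b) ℤ.- pos 11 ℤ.* pos b                 ≡⟨ cong (λ z → pos z ℤ.- pos 11 ℤ.* pos b)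
    (trans (m≡m%n+[m/n]*n (a + 10 * b) 11) (cong (_+ q * 11) eq)) ⟩
  pos 1 ℤ.+ pos (q * 11) ℤ.- pos 11 ℤ.* pos b           ≡⟨ cong (λ z → pos 1 ℤ.+ z ℤ.- pos 11 ℤ.* pos b) (ℤ.pos-* q 11) ⟩
  pos 1 ℤ.+ pos q ℤ.* pos 11 ℤ.- pos 11 ℤ.* pos b       ≡⟨ alg′ (pos q) (pos b) ⟩
  pos 1 ℤ.+ pos 11 ℤ.* (pos q ℤ.- pos b)                ∎)
  where
  open ≡-Reasoning
  q = (a + 10 * b) / 11
  alg : ∀ a b → a ℤ.- b ≡ a ℤ.+ pos 10 ℤ.* b ℤ.- pos 11 ℤ.* b
  alg = ℤ-Solver.solve-∀
  alg′ : ∀ q b → pos 1 ℤ.+ q ℤ.* pos 11 ℤ.- pos 11 ℤ.* b ≡ pos 1 ℤ.+ pos 11 ℤ.* (q ℤ.- b)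
  alg′ = ℤ-Solver.solve-∀

pos-residue : ∀ n j → pos n ≡ pos 1 ℤ.+ pos 11 ℤ.* j → n % 11 ≡ 1
pos-residue n (pos q) eq = trans (cong (_% 11) (ℤ.+-injective (trans eq
  (cong (λ z → pos 1 ℤ.+ z) (trans (ℤ.*-comm (pos 11) (pos q)) (sym (ℤ.pos-* q 11))))))) ([m+kn]%n≡m%n 1 q 11)
pos-residue n -[1+ q ] eq = ⊥-elim (<-irrefl (sym (ℤ.+-injective sum1)) 1<n+11q)
  where
  open ≡-Reasoning
  1<n+11q : 1 < n + 11 * suc q
  1<n+11q = ≤-trans (≤-trans (s≤s (s≤s (z≤n {9}))) (m≤m*n 11 (suc q))) (m≤n+m (11 * suc q) n)
  sum1 : pos (n + 11 * suc q) ≡ pos 1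
  sum1 = begin
    pos n ℤ.+ pos (11 * suc q)                                   ≡⟨ cong₂ ℤ._+_ eq (ℤ.pos-* 11 (suc q)) ⟩
    pos 1 ℤ.+ pos 11 ℤ.* -[1+ q ] ℤ.+ pos 11 ℤ.* (ℤ.- -[1+ q ])  ≡⟨ alg -[1+ q ] ⟩
    pos 1                                                        ∎
    where
    alg : ∀ z → pos 1 ℤ.+ pos 11 ℤ.* z ℤ.+ pos 11 ℤ.* (ℤ.- z) ≡ pos 1
    alg = ℤ-Solver.solve-∀

residue⇐ : ∀ a b k → pos a ℤ.- pos b ≡ pos 1 ℤ.+ pos 11 ℤ.* k → (a + 10 * b) % 11 ≡ 1
residue⇐ a b k eq = pos-residue (a + 10 * b) (k ℤ.+ pos b) (begin
  pos a ℤ.+ pos (10 * b)                                ≡⟨ cong (λ z → pos a ℤ.+ z) (ℤ.pos-* 10 b) ⟩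
  pos a ℤ.+ pos 10 ℤ.* pos b                            ≡⟨ alg (pos a) (pos b) ⟩
  pos a ℤ.- pos b ℤ.+ pos 11 ℤ.* pos b                  ≡⟨ cong (λ z → z ℤ.+ pos 11 ℤ.* pos b) eq ⟩
  pos 1 ℤ.+ pos 11 ℤ.* k ℤ.+ pos 11 ℤ.* pos b           ≡⟨ alg′ k (pos b) ⟩
  pos 1 ℤ.+ pos 11 ℤ.* (k ℤ.+ pos b)                    ∎)
  where
  open ≡-Reasoning
  alg : ∀ a b → a ℤ.+ pos 10 ℤ.* b ≡ a ℤ.- b ℤ.+ pos 11 ℤ.* b
  alg = ℤ-Solver.solve-∀
  alg′ : ∀ k b → pos 1 ℤ.+ pos 11 ℤ.* k ℤ.+ pos 11 ℤ.* b ≡ pos 1 ℤ.+ pos 11 ℤ.* (k ℤ.+ b)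
  alg′ = ℤ-Solver.solve-∀

-- Symbols of residue 1 and partitions of 11 n - 5

record UnitDiagrams (n : ℕ) (y : Diagrams) : Set where
  field
    neutral : total (charges y) ≡ pos 0
    energy  : total (energies y) ≡ pos (2 * n)
    unit    : ∃ λ k → dot ρ (charges y) ≡ pos 1 ℤ.+ pos 11 ℤ.* k

-- By `reversed-energy`, the field `energy` says that the diagram reassembled from the eleven
-- classes has doubled energy `2 * N`.
record FrobeniusDiagrams (N : ℕ) (y : Diagrams) : Set where
  field
    neutral : total (charges y) ≡ pos 0
    energy  : pos 11 ℤ.* total (energies y) ℤ.+ pos 2 ℤ.* dot ρ (charges y) ≡ pos (2 * N)

unit⇒ : ∀ n m → IsUnitSymbol n m → UnitDiagrams n (Straight.classes m)
unit⇒ n m@(s , t) ((same , w) , res) = record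
  { neutral = sum0
  ; energy  = trans (straight-energy s t same) (cong (λ k → pos (2 * k)) w)
  ; unit    = proj₁ r , trans (sym (straight-colors s t sum0)) (proj₂ r) }
  where
  sum0 = trans (sym (Straight.charge-total m)) (card⇒charge-0 s t same)
  r = residue⇒ (colors s) (colors t) res

unit⇐ : ∀ n m → UnitDiagrams n (Straight.classes m) → IsUnitSymbol n m
unit⇐ n m@(s , t) u =
  (same , *-cancelˡ-≡ (card s + (levelSum s + levelSum t)) n 2 (ℤ.+-injective (trans (sym (straight-energy s t same)) energy))) ,
  residue⇐ (colors s) (colors t) (proj₁ unit) (trans (straight-colors s t neutral) (proj₂ unit))
  where
  open UnitDiagrams u
  same : card s ≡ card t
  same = charge-0⇒card s t (trans (Straight.charge-total m) neutral)

frobenius⇒ : ∀ N m → IsFrobenius N m → FrobeniusDiagrams N (Reversed.classes m)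
frobenius⇒ N m frob = record
  { neutral = trans (sym (Reversed.charge-total m)) (proj₁ inv)
  ; energy  = trans (sym (reversed-energy m)) (trans (sym (invariant-charge-0 m (proj₁ inv))) (proj₂ inv)) }
  where inv = Frobenius⇒invariant m frob

frobenius⇐ : ∀ N m → FrobeniusDiagrams N (Reversed.classes m) → IsFrobenius N m
frobenius⇐ N m f = invariant⇒Frobenius m c0
  (trans (invariant-charge-0 m c0) (trans (reversed-energy m) energy))
  where
  open FrobeniusDiagrams f
  c0 : charge m ≡ pos 0
  c0 = trans (Reversed.charge-total m) neutral

module _ (n N : ℕ) (N+5≡11n : N + 5 ≡ 11 * n) where

  2N+10 : pos (2 * N) ℤ.+ pos 10 ≡ pos 11 ℤ.* pos (2 * n)
  2N+10 = begin
    pos (2 * N + 10)              ≡⟨ cong pos (*-distribˡ-+ 2 N 5) ⟨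
    pos (2 * (N + 5))             ≡⟨ cong (λ k → pos (2 * k)) N+5≡11n ⟩
    pos (2 * (11 * n))            ≡⟨ cong pos (alg n) ⟩
    pos (11 * (2 * n))            ≡⟨ ℤ.pos-* 11 (2 * n) ⟩
    pos 11 ℤ.* pos (2 * n)        ∎
    where
    open ≡-Reasoning
    alg : ∀ n → 2 * (11 * n) ≡ 11 * (2 * n)
    alg = ℕ-Solver.solve-∀

  -- The hypothesis gives e′ - e = |c′|² - |c|². `Neighbour-norm` evaluates 11 times this difference
  -- as the linear term in `ρ` and the constant 10, with signs reversed.
  energy-balance : ∀ {c c′} e e′ → Neighbour c c′ → e′ ℤ.+ dot c c ≡ e ℤ.+ dot c′ c′ →
    pos 11 ℤ.* e′ ℤ.+ pos 2 ℤ.* dot ρ c′ ℤ.+ pos 10 ≡ pos 11 ℤ.* e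
  energy-balance {c} {c′} e e′ nb eq = begin
    pos 11 ℤ.* e′ ℤ.+ pos 2 ℤ.* r ℤ.+ pos 10
      ≡⟨ alg₁ e′ (dot c c) r (dot c′ c′) ⟩
    pos 11 ℤ.* (e′ ℤ.+ dot c c) ℤ.+ (pos 11 ℤ.* dot c′ c′ ℤ.+ pos 2 ℤ.* r ℤ.+ pos 10) ℤ.- pos 11 ℤ.* dot c c ℤ.- pos 11 ℤ.* dot c′ c′
      ≡⟨ cong₂ (λ x y → pos 11 ℤ.* x ℤ.+ y ℤ.- pos 11 ℤ.* dot c c ℤ.- pos 11 ℤ.* dot c′ c′) eq (Neighbour-norm nb) ⟩
    pos 11 ℤ.* (e ℤ.+ dot c′ c′) ℤ.+ pos 11 ℤ.* dot c c ℤ.- pos 11 ℤ.* dot c c ℤ.- pos 11 ℤ.* dot c′ c′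
      ≡⟨ alg₂ e (dot c c) (dot c′ c′) ⟩
    pos 11 ℤ.* e ∎
    where
    open ≡-Reasoning
    r = dot ρ c′
    alg₁ : ∀ e a r b → pos 11 ℤ.* e ℤ.+ pos 2 ℤ.* r ℤ.+ pos 10 ≡
      pos 11 ℤ.* (e ℤ.+ a) ℤ.+ (pos 11 ℤ.* b ℤ.+ pos 2 ℤ.* r ℤ.+ pos 10) ℤ.- pos 11 ℤ.* a ℤ.- pos 11 ℤ.* b
    alg₁ = ℤ-Solver.solve-∀
    alg₂ : ∀ e a b → pos 11 ℤ.* (e ℤ.+ b) ℤ.+ pos 11 ℤ.* a ℤ.- pos 11 ℤ.* a ℤ.- pos 11 ℤ.* b ≡ pos 11 ℤ.* e
    alg₂ = ℤ-Solver.solve-∀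

  -- The energy equation gives 2 (r + 5) = 11 (2 n - e). The factor 2 is inverted modulo 11 by 1 =
  -- 11 - 5 · 2, which is where the multiplier 5 of `pos (2 * n) ℤ.- e` comes from.
  frobenius-residue : ∀ e r → pos 11 ℤ.* e ℤ.+ pos 2 ℤ.* r ≡ pos (2 * N) →
    r ℤ.+ pos 5 ≡ pos 11 ℤ.* (r ℤ.+ pos 5 ℤ.- pos 5 ℤ.* (pos (2 * n) ℤ.- e))
  frobenius-residue e r eq = begin
    r ℤ.+ pos 5
      ≡⟨ alg₁ e r ⟩
    pos 11 ℤ.* (r ℤ.+ pos 5) ℤ.- pos 5 ℤ.* (pos 11 ℤ.* e ℤ.+ pos 2 ℤ.* r ℤ.+ pos 10 ℤ.- pos 11 ℤ.* e)
      ≡⟨ cong (λ z → pos 11 ℤ.* (r ℤ.+ pos 5) ℤ.- pos 5 ℤ.* (z ℤ.- pos 11 ℤ.* e))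
           (trans (cong (λ z → z ℤ.+ pos 10) eq) 2N+10) ⟩
    pos 11 ℤ.* (r ℤ.+ pos 5) ℤ.- pos 5 ℤ.* (pos 11 ℤ.* pos (2 * n) ℤ.- pos 11 ℤ.* e)
      ≡⟨ alg₂ e r (pos (2 * n)) ⟩
    pos 11 ℤ.* (r ℤ.+ pos 5 ℤ.- pos 5 ℤ.* (pos (2 * n) ℤ.- e)) ∎
    where
    open ≡-Reasoning
    alg₁ : ∀ e r → r ℤ.+ pos 5 ≡
      pos 11 ℤ.* (r ℤ.+ pos 5) ℤ.- pos 5 ℤ.* (pos 11 ℤ.* e ℤ.+ pos 2 ℤ.* r ℤ.+ pos 10 ℤ.- pos 11 ℤ.* e)
    alg₁ = ℤ-Solver.solve-∀
    alg₂ : ∀ e r n → pos 11 ℤ.* (r ℤ.+ pos 5) ℤ.- pos 5 ℤ.* (pos 11 ℤ.* n ℤ.- pos 11 ℤ.* e) ≡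
      pos 11 ℤ.* (r ℤ.+ pos 5 ℤ.- pos 5 ℤ.* (n ℤ.- e))
    alg₂ = ℤ-Solver.solve-∀

  unit→frobenius : ∀ y c′ → Neighbour (charges y) c′ → UnitDiagrams n y → FrobeniusDiagrams N (move c′ y)
  unit→frobenius y c′ nb u = record
    { neutral = trans (total-cong (charges-move c′ y)) (trans (Neighbour-total nb) neutral)
    ; energy  = ℤ-Group.∙-cancelʳ (pos 10) _ (pos (2 * N)) (begin
        pos 11 ℤ.* total (energies y′) ℤ.+ pos 2 ℤ.* dot ρ (charges y′) ℤ.+ pos 10
          ≡⟨ cong (λ d → pos 11 ℤ.* total (energies y′) ℤ.+ pos 2 ℤ.* d ℤ.+ pos 10)
               (dot-cong (λ i → refl {x = ρ i}) (charges-move c′ y)) ⟩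
        pos 11 ℤ.* total (energies y′) ℤ.+ pos 2 ℤ.* dot ρ c′ ℤ.+ pos 10
          ≡⟨ energy-balance (total (energies y)) (total (energies y′)) nb (energy-move c′ y) ⟩
        pos 11 ℤ.* total (energies y)     ≡⟨ cong (λ e → pos 11 ℤ.* e) energy ⟩
        pos 11 ℤ.* pos (2 * n)            ≡⟨ 2N+10 ⟨
        pos (2 * N) ℤ.+ pos 10            ∎) }
    where
    open ≡-Reasoning
    open UnitDiagrams u
    y′ = move c′ y

  frobenius→unit : ∀ y′ c → Neighbour c (charges y′) → FrobeniusDiagrams N y′ → UnitDiagrams n (move c y′)
  frobenius→unit y′ c nb f = record
    { neutral = sum0
    ; energy  = ℤ.*-cancelˡ-≡ (pos 11) (total (energies y)) (pos (2 * n)) (begin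
        pos 11 ℤ.* total (energies y)     ≡⟨ energy-balance (total (energies y)) (total (energies y′)) nb (sym (energy-move c y′)) ⟨
        pos 11 ℤ.* total (energies y′) ℤ.+ pos 2 ℤ.* dot ρ (charges y′) ℤ.+ pos 10
          ≡⟨ cong (λ z → z ℤ.+ pos 10) energy ⟩
        pos (2 * N) ℤ.+ pos 10            ≡⟨ 2N+10 ⟩
        pos 11 ℤ.* pos (2 * n)            ∎)
    ; unit    = Neighbour-residue (Neighbour-cong (λ i → sym (charges-move c y′ i)) (λ _ → refl) nb) sum0 }
    where
    open ≡-Reasoning
    open FrobeniusDiagrams f
    y = move c y′
    sum0 : total (charges y) ≡ pos 0
    sum0 = trans (total-cong (charges-move c y′)) (trans (sym (Neighbour-total nb)) neutral)

  -- From here on only the relation `Neighbour` is used, not the explicit vectors; it determines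
  -- either end from the other.
  abstract
    toNeighbour : ∀ y → UnitDiagrams n y → Σ (Point 11) (Neighbour (charges y))
    toNeighbour y u = forward (charges y) (proj₁ unit) neutral (proj₂ unit)
      where open UnitDiagrams u

    fromNeighbour : ∀ y′ → FrobeniusDiagrams N y′ → Σ (Point 11) (λ c → Neighbour c (charges y′))
    fromNeighbour y′ f = backward (charges y′) _ neutral (frobenius-residue (total (energies y′)) (dot ρ (charges y′)) energy)
      where open FrobeniusDiagrams f

  -- `Neighbour` is one-to-one, so `d` must be the original charge vector, and moving back to it
  -- restores every diagram.
  move-roundtripˡ : ∀ y y″ c′ d → y″ ≡ move c′ y → Neighbour (charges y) c′ → Neighbour d (charges y″) → move d y″ ≡ y
  move-roundtripˡ y y″ c′ d refl nb nb′ = move-move c′ d y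
    (Neighbour-uniqueˡ (Neighbour-cong (λ _ → refl) (charges-move c′ y) nb′) nb)

  move-roundtripʳ : ∀ y y″ c d → y″ ≡ move c y → Neighbour c (charges y) → Neighbour (charges y″) d → move d y″ ≡ y
  move-roundtripʳ y y″ c d refl nb nb′ = move-move c d y
    (Neighbour-uniqueʳ (Neighbour-cong (charges-move c y) (λ _ → refl) nb′) nb)

  UnitSymbol↔Frobenius : Σ Maya (IsUnitSymbol n) ↔ Σ Maya (IsFrobenius N)
  UnitSymbol↔Frobenius = subset-↔ (λ {m} → IsUnitSymbol-irrelevant n {m}) (λ {m} → IsFrobenius-irrelevant N {m})
    to from from∘to to∘from
    where
    module To (x : Σ Maya (IsUnitSymbol n)) where
      y : Diagrams
      y = Straight.classes (proj₁ x)
      u : UnitDiagrams n y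
      u = unit⇒ n (proj₁ x) (proj₂ x)
      c′ : Point 11
      c′ = proj₁ (toNeighbour y u)
      nb : Neighbour (charges y) c′
      nb = proj₂ (toNeighbour y u)
      m′ : Maya
      m′ = Reversed.unclasses (move c′ y)

    module From (x : Σ Maya (IsFrobenius N)) where
      y : Diagrams
      y = Reversed.classes (proj₁ x)
      f : FrobeniusDiagrams N y
      f = frobenius⇒ N (proj₁ x) (proj₂ x)
      c : Point 11
      c = proj₁ (fromNeighbour y f)
      nb : Neighbour c (charges y)
      nb = proj₂ (fromNeighbour y f)
      m : Maya
      m = Straight.unclasses (move c y)

    to : Σ Maya (IsUnitSymbol n) → Σ Maya (IsFrobenius N)
    to x = m′ , frobenius⇐ N m′ (subst (FrobeniusDiagrams N) (sym (Reversed.classes-unclasses (move c′ y)))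
      (unit→frobenius y c′ nb u))
      where open To x

    from : Σ Maya (IsFrobenius N) → Σ Maya (IsUnitSymbol n)
    from x = m , unit⇐ n m (subst (UnitDiagrams n) (sym (Straight.classes-unclasses (move c y)))
      (frobenius→unit y c nb f))
      where open From x

    from∘to : ∀ x → proj₁ (from (to x)) ≡ proj₁ x
    from∘to x = trans
      (cong Straight.unclasses (move-roundtripˡ y (From.y (to x)) c′ (From.c (to x))
        (Reversed.classes-unclasses (move c′ y)) nb (From.nb (to x))))
      (Straight.unclasses-classes (proj₁ x))
      where open To x

    to∘from : ∀ x → proj₁ (to (from x)) ≡ proj₁ x
    to∘from x = trans
      (cong Reversed.unclasses (move-roundtripʳ y (To.y (from x)) c (To.c′ (from x))
        (Straight.classes-unclasses (move c y)) nb (To.nb (from x))))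
      (Reversed.unclasses-classes (proj₁ x))
      where open From x

-- Counting

HasSize-empty : ∀ {A : Set} → ¬ A → HasSize A 0
HasSize-empty ¬a = mk↔ₛ′ (⊥-elim ∘ ¬a) (λ ()) (λ ()) (⊥-elim ∘ ¬a)

Full↔Frobenius : ∀ n q → n ≡ 11 * q → Σ Maya (IsFull n) ↔ Σ Maya (IsFrobenius q)
Full↔Frobenius n q eq = subset-↔ (λ {m} → IsFull-irrelevant n {m}) (λ {m} → IsFrobenius-irrelevant q {m})
  (λ (m , same , w) → m , same , *-cancelˡ-≡ _ q 11 (trans w eq))
  (λ (m , same , w) → m , same , trans (cong (11 *_) w) (sym eq))
  (λ _ → refl) (λ _ → refl)

no-full : ∀ n → n % 11 ≢ 0 → ¬ Σ Maya (IsFull n)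
no-full n n%11≢0 ((s , t) , _ , w) = n%11≢0
  (trans (cong (_% 11) (trans (sym w) (*-comm 11 k))) (m*n%n≡0 k 11))
  where k = card s + (elementSum s + elementSum t)

-- The only symbol of weight 0 is empty and has residue 0. This matches the sum on the right, which
-- starts at j = 1.
no-unit-symbol-0 : ¬ Σ Maya (IsUnitSymbol 0)
no-unit-symbol-0 ((s , t) , (same , w) , res) = go s t (m+n≡0⇒m≡0 (card s) w) same res
  where
  go : ∀ s t → card s ≡ 0 → card s ≡ card t → residue (s , t) ≢ 1
  go [] [] _ _ ()

Frobenius-size : ∀ {p : ℕ → ℕ} → (∀ m → HasSize (Partition m) (p m)) → ∀ m → HasSize (Σ Maya (IsFrobenius m)) (p m)
Frobenius-size sizes m = sizes m ↔-∘ (↔-sym (Partition↔FinSet m) ↔-∘ ↔-sym (FinSet↔Frobenius m))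

-- The two summands are the symbols without mixed level and the eleven equinumerous residue classes
-- of the others.
CFrob-size : ∀ n {a b} → HasSize (Σ Maya (IsFull n)) a → HasSize (Σ Maya (IsUnitSymbol n)) b →
  HasSize (CFrob 11 n) (a + 11 * b)
CFrob-size n {a} {b} full unit =
  (↔-sym (+↔⊎ {a} {11 * b}) ↔-∘ (full ⊎-↔ (↔-sym (*↔× {11} {b}) ↔-∘ (↔-id (Fin 11) ×-↔ unit))))
  ↔-∘ (Symbol-decomposition n ↔-∘ CFrob↔Symbol 11 n)

theorem3p5 : (p : ℕ → ℕ) → ((m : ℕ) → HasSize (Partition m) (p m)) →
    (n : ℕ) → HasSize (CFrob 11 n) (rhsCoeff p n)
theorem3p5 p sizes zero = subst (HasSize (CFrob 11 0)) (+-identityʳ (p 0))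
  (CFrob-size 0 (Frobenius-size sizes 0 ↔-∘ Full↔Frobenius 0 0 refl) (HasSize-empty no-unit-symbol-0))
theorem3p5 p sizes (suc m) with suc m % 11 ≟ 0
... | yes 11∣n = CFrob-size (suc m)
  (Frobenius-size sizes (suc m / 11) ↔-∘ Full↔Frobenius (suc m) (suc m / 11) quotient) unit
  where
  quotient : suc m ≡ 11 * (suc m / 11)
  quotient = trans (m≡m%n+[m/n]*n (suc m) 11) (trans (cong (_+ suc m / 11 * 11) 11∣n) (*-comm (suc m / 11) 11))
  unit = Frobenius-size sizes (11 * suc m ∸ 5) ↔-∘ UnitSymbol↔Frobenius (suc m) (11 * suc m ∸ 5)
    -- The truncated subtraction is exact, since 5 ≤ 11 ≤ 11 n.
    (m∸n+n≡m (≤-trans (m≤m+n 5 6) (m≤m*n 11 (suc m))))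
... | no 11∤n = CFrob-size (suc m) (HasSize-empty (no-full (suc m) 11∤n)) unit
  where
  unit = Frobenius-size sizes (11 * suc m ∸ 5) ↔-∘ UnitSymbol↔Frobenius (suc m) (11 * suc m ∸ 5)
    (m∸n+n≡m (≤-trans (m≤m+n 5 6) (m≤m*n 11 (suc m))))
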